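{- For every integer $k$ with $1\le k\le 50{,}000{,}000$, the following two conditions are equivalent: (i) for every integer $n>1$ the open interval $(kn,(k+1)n)$ contains a prime; (ii) $k\in\{1,2,3,5,9,14\}$. -}

module Defs where

-- For k = 14 (and then for the smaller exceptional k) primes in (y, 15y/14) come from a
-- Chebyshev-Sylvester argument.  By Legendre's formula log ⌊x/D⌋! = Σ Λ(q) ⌊x/(Dq)⌋, so a linear
-- combination of such logarithms weights Λ(q) by a function of ⌊x/q⌋ only.  Two combinations
-- improve the trivial bound for ψ(x) to ψ(x) ≤ 1.065 x + O(log x).  A third one, at x = 15y, has weight
-- at most 1 where ⌊x/q⌋ = 14, that is y < q ≤ 15y/14, and weight at most 0 elsewhere, up to multiples of
-- ψ(x/T) that the previous bound controls; as it grows linearly in x, there is a prime among these q.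
-- All inequalities are stated multiplicatively, between natural numbers, and small y are
-- settled by an explicit chain of primes.
--
-- For the other k one needs some n such that kn + 1, …, kn + n - 1 are all composite.  Mostly
-- the residue of k modulo 510510 already provides a common factor for each of them; the remaining k are
-- treated one by one, using common factors with 2000!.
module Submission where

open import Defs
open import Agda.Builtin.Nat using (mod-helper)
open import Data.Bool using (Bool; true; false; _∧_; _∨_; not; T)
open import Data.Bool.Properties using (T-∧; T-∨; T-≡)
open import Data.List using (List; []; _∷_)
open import Data.List.Membership.DecPropositional using (_∈?_)
open import Data.List.Membership.Propositional using (_∈_)
open import Data.List.Relation.Unary.All using (All; []; _∷_)
open import Data.List.Relation.Unary.Any using (here; there)
open import Data.Nat
open import Data.Nat.Divisibility
open import Data.Nat.DivMod
open import Data.Nat.Induction using (<-rec)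
open import Data.Nat.ListAction using (product)
open import Data.Nat.Primality
open import Data.Nat.Primality.Factorisation using (factorise; factors; PrimeFactorisation)
open import Data.Nat.Properties
open import Data.Nat.Tactic.RingSolver using (solve-∀)
open import Data.Product using (∃; _×_; _,_; proj₁; proj₂)
open import Data.Sum using (_⊎_; inj₁; inj₂)
open import Data.Unit using (tt)
open import Function using (_∘_; Equivalence)
open import Function.Bundles using (_⇔_; mk⇔)
open import Relation.Binary.PropositionalEquality hiding ([_])
open import Relation.Nullary
open import Relation.Nullary.Decidable using (⌊_⌋; toWitness)

-- Products over prime powers

-- One estimate serves all six exceptional values, because (k + 1)/k ≥ 15/14 whenever k ≤ 14.
-- Positive weights at quotients other than 14 are paid for at the slope of the available bound for
-- ψ, so this slope has to be close to 1. Each improvement feeds the previous bound into a finer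
-- combination, starting from ψ(x) ≤ 4 x log 2. An obstacle is that proper prime powers q with ⌊x/q⌋
-- = 14 are counted as well. Only primes up to about √x have such powers, and each contributes at
-- most log x, so the total is O(√x log x) against a linear surplus. The surplus is small and is
-- shown to win only from x = 4 ^ 18 on; this fixes how far the chain of primes must reach. In the
-- other direction no factorisations are computed. If B < 2k, every prime p > kn ≥ 2k is prime to
-- B!, so a common factor with B! shows that a number in the interval is not prime. For k ≥ 1024
-- this allows B = 2000.

∏ : ℕ → (ℕ → ℕ) → ℕ
∏ zero    f = 1
∏ (suc n) f = ∏ n f * f (suc n)

∏-cong : ∀ n {f g : ℕ → ℕ} → (∀ i → 1 ≤ i → i ≤ n → f i ≡ g i) → ∏ n f ≡ ∏ n g
∏-cong zero    f≡g = refl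
∏-cong (suc n) f≡g = cong₂ _*_ (∏-cong n λ i 1≤i i≤n → f≡g i 1≤i (m≤n⇒m≤1+n i≤n)) (f≡g (suc n) z<s ≤-refl)

∏-mono-≤ : ∀ n {f g : ℕ → ℕ} → (∀ i → 1 ≤ i → i ≤ n → f i ≤ g i) → ∏ n f ≤ ∏ n g
∏-mono-≤ zero    f≤g = ≤-refl
∏-mono-≤ (suc n) f≤g = *-mono-≤ (∏-mono-≤ n λ i 1≤i i≤n → f≤g i 1≤i (m≤n⇒m≤1+n i≤n)) (f≤g (suc n) z<s ≤-refl)

∏-distrib-* : ∀ n (f g : ℕ → ℕ) → ∏ n (λ i → f i * g i) ≡ ∏ n f * ∏ n g
∏-distrib-* zero    f g = refl
∏-distrib-* (suc n) f g = trans (cong (_* (f (suc n) * g (suc n))) (∏-distrib-* n f g))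
  ([m*n]*[o*p]≡[m*o]*[n*p] (∏ n f) (∏ n g) (f (suc n)) (g (suc n)))

^-distribʳ-* : ∀ m n o → (m * n) ^ o ≡ m ^ o * n ^ o
^-distribʳ-* m n zero    = refl
^-distribʳ-* m n (suc o) = trans (cong (m * n *_) (^-distribʳ-* m n o)) ([m*n]*[o*p]≡[m*o]*[n*p] m n (m ^ o) (n ^ o))

∏-distrib-^ : ∀ n (f : ℕ → ℕ) c → ∏ n (λ i → f i ^ c) ≡ ∏ n f ^ c
∏-distrib-^ zero    f c = sym (^-zeroˡ c)
∏-distrib-^ (suc n) f c = trans (cong (_* f (suc n) ^ c) (∏-distrib-^ n f c)) (sym (^-distribʳ-* (∏ n f) (f (suc n)) c))

∏-ones : ∀ n {f : ℕ → ℕ} → (∀ i → 1 ≤ i → i ≤ n → f i ≡ 1) → ∏ n f ≡ 1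
∏-ones zero    f≡1 = refl
∏-ones (suc n) f≡1 = cong₂ _*_ (∏-ones n λ i 1≤i i≤n → f≡1 i 1≤i (m≤n⇒m≤1+n i≤n)) (f≡1 (suc n) z<s ≤-refl)

∏-shift : ∀ n (f : ℕ → ℕ) → ∏ (suc n) f ≡ f 1 * ∏ n (f ∘ suc)
∏-shift zero    f = trans (+-identityʳ (f 1)) (sym (*-identityʳ (f 1)))
∏-shift (suc n) f = trans (cong (_* f (2 + n)) (∏-shift n f)) (*-assoc (f 1) (∏ n (f ∘ suc)) (f (2 + n)))

-- The quotient is 0 when the divisor is 0.
infixl 7 _÷_
_÷_ : ℕ → ℕ → ℕ
m ÷ zero  = 0
m ÷ suc n = m / suc n

÷-÷-comm : ∀ m n o → m ÷ n ÷ o ≡ m ÷ o ÷ n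
÷-÷-comm m zero    zero    = refl
÷-÷-comm m zero    (suc o) = refl
÷-÷-comm m (suc n) zero    = refl
÷-÷-comm m (suc n) (suc o) = begin
  m / suc n / suc o   ≡⟨ m/n/o≡m/[n*o] m (suc n) (suc o) ⟩
  m / (suc n * suc o) ≡⟨ /-congʳ {m = m} (*-comm (suc n) (suc o)) ⟩
  m / (suc o * suc n) ≡⟨ m/n/o≡m/[n*o] m (suc o) (suc n) ⟨
  m / suc o / suc n   ∎
  where open ≡-Reasoning

÷-monoˡ-≤ : ∀ {m n} o → m ≤ n → m ÷ o ≤ n ÷ o
÷-monoˡ-≤ zero    m≤n = z≤n
÷-monoˡ-≤ (suc o) m≤n = /-monoˡ-≤ (suc o) m≤n

m÷n≤m : ∀ m n → m ÷ n ≤ m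
m÷n≤m m zero    = z≤n
m÷n≤m m (suc n) = m/n≤m m (suc n)

n*[m÷n]≤m : ∀ m n → n * (m ÷ n) ≤ m
n*[m÷n]≤m m zero    = z≤n
n*[m÷n]≤m m (suc n) = ≤-trans (≤-reflexive (*-comm (suc n) (m / suc n))) (m/n*n≤m m (suc n))

n*k÷n : ∀ n k → 1 ≤ n → n * k ÷ n ≡ k
n*k÷n n@(suc _) k _ = trans (/-congˡ {o = n} (*-comm n k)) (m*n/n≡m k n)

÷≡0 : ∀ {m n} → m < n → m ÷ n ≡ 0
÷≡0 {n = suc n} m<n = m<n⇒m/n≡0 m<n

[_∣_] : ℕ → ℕ → ℕ
[ q ∣ n ] with q ∣? n
... | yes _ = 1
... | no  _ = 0

[∣]-yes : ∀ {q n} → q ∣ n → [ q ∣ n ] ≡ 1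
[∣]-yes {q} {n} q∣n with q ∣? n
... | yes _ = refl
... | no ¬p = contradiction q∣n ¬p

[∣]-no : ∀ {q n} → ¬ q ∣ n → [ q ∣ n ] ≡ 0
[∣]-no {q} {n} q∤n with q ∣? n
... | yes p = contradiction p q∤n
... | no _  = refl

[∣]-cong : ∀ {q n r m} → (q ∣ n → r ∣ m) → (r ∣ m → q ∣ n) → [ q ∣ n ] ≡ [ r ∣ m ]
[∣]-cong {q} {n} f g with q ∣? n
... | yes p = sym ([∣]-yes (f p))
... | no ¬p = sym ([∣]-no (¬p ∘ g))

-- Both sides count the multiples of q in the interval from 1 to n + 1.
suc-÷ : ∀ n q → 1 ≤ q → suc n ÷ q ≡ n ÷ q + [ q ∣ suc n ]
suc-÷ n q@(suc _) 1≤q with q ∣? suc n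
... | yes (divides (suc k) eq) = begin
      suc n / q           ≡⟨ cong (_/ q) eq ⟩
      suc k * q / q       ≡⟨ m*n/n≡m (suc k) q ⟩
      suc k               ≡⟨ +-comm 1 k ⟩
      k + 1               ≡⟨ cong (_+ 1) (≤-antisym k≤ ≤k) ⟩
      n / q + 1           ∎
  where
  open ≡-Reasoning
  k≤ : k ≤ n / q
  k≤ = subst (_≤ n / q) (m*n/n≡m k q) (/-monoˡ-≤ q (≤-pred (≤-trans (s≤s (m≤n+m (k * q) _)) (≤-reflexive (sym eq)))))
  ≤k : n / q ≤ k
  ≤k = ≤-pred (m<n*o⇒m/o<n (subst (n <_) eq ≤-refl))
... | yes (divides zero ())
... | no q∤ = trans (≤-antisym (≮⇒≥ λ lt → q∤ (divides (suc (n / q)) (≤-antisym (upper lt) (lower lt)))) (/-monoˡ-≤ q (n≤1+n n))) (sym (+-identityʳ _))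
  where
  lower : n / q < suc n / q → suc (n / q) * q ≤ suc n
  lower lt = ≤-trans (*-monoˡ-≤ q lt) (m/n*n≤m (suc n) q)
  upper : n / q < suc n / q → suc n ≤ suc (n / q) * q
  upper lt = subst (_< suc (n / q) * q) (sym (m≡m%n+[m/n]*n n q)) (+-monoˡ-< _ (m%n<n n q))

-- Von Mangoldt's function at the powers of p is log (base p).
base : ℕ → ℕ
base p with prime? p
... | yes _ = p
... | no _  = 1

base≥1 : ∀ p → 1 ≤ base p
base≥1 p with prime? p
... | yes pp = >-nonZero⁻¹ p {{prime⇒nonZero pp}}
... | no _   = ≤-refl

base≤ : ∀ p → 1 ≤ p → base p ≤ p
base≤ p 1≤p with prime? p
... | yes _ = ≤-refl
... | no  _ = 1≤p

∃-primeDivisor : ∀ n → 2 ≤ n → ∃ λ p → Prime p × p ∣ n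
∃-primeDivisor n 2≤n = go (factors f) (PrimeFactorisation.isFactorisation f) (PrimeFactorisation.factorsPrime f)
  where
  instance
    _ : NonZero n
    _ = >-nonZero (<-trans z<s 2≤n)
  f = factorise n
  go : (ps : List ℕ) → n ≡ product ps → All Prime ps → ∃ λ p → Prime p × p ∣ n
  go []       eq _         = contradiction (subst (2 ≤_) eq 2≤n) λ { (s≤s ()) }
  go (p ∷ ps) eq (pp ∷ _) = p , pp , divides (product ps) (trans eq (*-comm p (product ps)))

n<m^n : ∀ m n → 2 ≤ m → n < m ^ n
n<m^n m zero    2≤m = s≤s z≤n
n<m^n m (suc n) 2≤m = begin-strict
  suc n       ≤⟨ n<m^n m n 2≤m ⟩
  m ^ n       <⟨ m<m*n (m ^ n) m {{>-nonZero (≤-trans (s≤s z≤n) (n<m^n m n 2≤m))}} 2≤m ⟩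
  m ^ n * m   ≡⟨ *-comm (m ^ n) m ⟩
  m * m ^ n   ∎
  where open ≤-Reasoning

-- Every prime power q ≤ N is p ^ j for some p, j ≤ N, so log ⟦ g ⟧ is the sum of
-- Λ(q) g(q) over all prime powers q ≤ N whenever g vanishes beyond N.
module Weights (N : ℕ) where

  ⟦_⟧ : (ℕ → ℕ) → ℕ
  ⟦ g ⟧ = ∏ N λ p → ∏ N λ j → base p ^ g (p ^ j)

  1≤p^ : ∀ p j → 1 ≤ p → 1 ≤ p ^ j
  1≤p^ p j 1≤p = m^n>0 p {{>-nonZero 1≤p}} j

  ⟦⟧-cong : ∀ {g h} → (∀ q → 1 ≤ q → g q ≡ h q) → ⟦ g ⟧ ≡ ⟦ h ⟧
  ⟦⟧-cong g≡h = ∏-cong N λ p 1≤p _ → ∏-cong N λ j _ _ → cong (base p ^_) (g≡h (p ^ j) (1≤p^ p j 1≤p))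

  ⟦⟧-mono-≤ : ∀ {g h} → (∀ q → 1 ≤ q → g q ≤ h q) → ⟦ g ⟧ ≤ ⟦ h ⟧
  ⟦⟧-mono-≤ g≤h = ∏-mono-≤ N λ p 1≤p _ → ∏-mono-≤ N λ j _ _ →
    ^-monoʳ-≤ (base p) {{>-nonZero (base≥1 p)}} (g≤h (p ^ j) (1≤p^ p j 1≤p))

  ⟦⟧-+ : ∀ g h → ⟦ (λ q → g q + h q) ⟧ ≡ ⟦ g ⟧ * ⟦ h ⟧
  ⟦⟧-+ g h = trans
    (∏-cong N λ p _ _ → trans (∏-cong N λ j _ _ → ^-distribˡ-+-* (base p) (g (p ^ j)) (h (p ^ j))) (∏-distrib-* N _ _))
    (∏-distrib-* N _ _)

  ⟦⟧-* : ∀ c g → ⟦ (λ q → c * g q) ⟧ ≡ ⟦ g ⟧ ^ c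
  ⟦⟧-* c g = trans
    (∏-cong N λ p _ _ → trans (∏-cong N λ j _ _ → trans (cong (base p ^_) (*-comm c (g (p ^ j)))) (sym (^-*-assoc (base p) (g (p ^ j)) c)))
                              (∏-distrib-^ N _ c))
    (∏-distrib-^ N _ c)

  ⟦0⟧ : ⟦ (λ _ → 0) ⟧ ≡ 1
  ⟦0⟧ = ∏-ones N λ p _ _ → ∏-ones N λ j _ _ → refl

  -- Writes a single prime p₀ as a product over all p, so that passing from m to p₀ * m can be
  -- verified separately for each p.
  pick : ℕ → ℕ → ℕ
  pick p₀ p with p ≟ p₀
  ... | yes _ = p₀
  ... | no _  = 1

  ∏-pick-< : ∀ p₀ n → n < p₀ → ∏ n (pick p₀) ≡ 1
  ∏-pick-< p₀ n n<p₀ = ∏-ones n λ i _ i≤n → h i (<⇒≢ (≤-<-trans i≤n n<p₀))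
    where
    h : ∀ i → i ≢ p₀ → pick p₀ i ≡ 1
    h i i≢ with i ≟ p₀
    ... | yes e = contradiction e i≢
    ... | no _  = refl

  ∏-pick : ∀ p₀ n → 1 ≤ p₀ → p₀ ≤ n → ∏ n (pick p₀) ≡ p₀
  ∏-pick p₀ zero    1≤p₀ p₀≤n = contradiction (≤-trans 1≤p₀ p₀≤n) λ ()
  ∏-pick p₀ (suc n) 1≤p₀ p₀≤n with suc n ≟ p₀
  ... | yes refl = trans (cong (_* suc n) (∏-pick-< (suc n) n ≤-refl)) (+-identityʳ (suc n))
  ... | no ne    = trans (*-identityʳ _) (∏-pick p₀ n 1≤p₀ (≤-pred (≤∧≢⇒< p₀≤n (ne ∘ sym))))

  -- Since p ^ N > N, cutting the exponents j off at N loses no prime power divisor, and even the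
  -- exponent N contributes nothing. This leaves room for the shift by one in `factor-step`.
  p^∤ : ∀ {p} n → Prime p → 1 ≤ n → n ≤ N → ¬ p ^ N ∣ n
  p^∤ {p} n pp 1≤n n≤N d = <⇒≱ (n<m^n p N (nonTrivial⇒n>1 p {{prime⇒nonTrivial pp}})) (≤-trans (∣⇒≤ {{>-nonZero 1≤n}} d) n≤N)

  -- For p = p₀ the divisors p ^ j of p * m are those of m shifted by one,
  -- together with p itself; for p ≠ p₀ they are those of m.
  factor-step : ∀ p₀ m → Prime p₀ → 1 ≤ m → m ≤ N → ∀ p →
    (∏ N λ j → base p ^ [ p ^ j ∣ p₀ * m ]) ≡ (∏ N λ j → base p ^ [ p ^ j ∣ m ]) * pick p₀ p
  factor-step p₀ m pp₀ 1≤m m≤N p with prime? p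
  ... | no ¬pp = trans (∏-ones N λ j _ _ → ^-zeroˡ [ p ^ j ∣ p₀ * m ]) (sym (cong₂ _*_ (∏-ones N λ j _ _ → ^-zeroˡ [ p ^ j ∣ m ]) (pick≡1 (λ { refl → ¬pp pp₀ }))))
    where
    pick≡1 : p ≢ p₀ → pick p₀ p ≡ 1
    pick≡1 p≢ with p ≟ p₀
    ... | yes e = contradiction e p≢
    ... | no _  = refl
  ... | yes pp with p ≟ p₀
  ...   | no p≢ = trans (∏-cong N λ j _ _ → cong (p ^_) ([∣]-cong (coprime-part j m) (λ d → ∣n⇒∣m*n p₀ d))) (sym (*-identityʳ _))
    where
    coprime-part : ∀ j m → p ^ j ∣ p₀ * m → p ^ j ∣ m
    coprime-part zero    m d = 1∣ m
    coprime-part (suc j) m d with euclidsLemma p₀ m pp (∣-trans (divides (p ^ j) (*-comm p (p ^ j))) d)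
    ... | inj₁ p∣p₀ with prime⇒irreducible pp₀ p∣p₀
    ...   | inj₁ p≡1 = contradiction pp (subst (¬_ ∘ Prime) (sym p≡1) ¬prime[1])
    ...   | inj₂ e   = contradiction e p≢
    coprime-part (suc j) m d | inj₂ (divides k refl) = subst (p * p ^ j ∣_) (*-comm p k) (*-monoʳ-∣ p
      (coprime-part j k (*-cancelˡ-∣ p {{prime⇒nonZero pp}} (subst (p * p ^ j ∣_) (rearr p₀ k p) d))))
      where
      rearr : ∀ a b c → a * (b * c) ≡ c * (a * b)
      rearr = solve-∀
  ...   | yes refl = lemma N refl
    where
    instance
      _ : NonZero p
      _ = prime⇒nonZero pp
    shift : ∀ j → [ p ^ suc j ∣ p * m ] ≡ [ p ^ j ∣ m ]
    shift j = [∣]-cong {p ^ suc j} {p * m} (*-cancelˡ-∣ p) (*-monoʳ-∣ p)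
    lemma : ∀ n → n ≡ N → (∏ n λ j → p ^ [ p ^ j ∣ p * m ]) ≡ (∏ n λ j → p ^ [ p ^ j ∣ m ]) * p
    lemma zero     0≡N = contradiction (≤-trans 1≤m (subst (m ≤_) (sym 0≡N) m≤N)) λ ()
    lemma (suc N′) eqN = begin
      ∏ (suc N′) (λ j → p ^ [ p ^ j ∣ p * m ])                 ≡⟨ ∏-shift N′ _ ⟩
      p ^ [ p ^ 1 ∣ p * m ] * ∏ N′ (λ j → p ^ [ p ^ suc j ∣ p * m ])
        ≡⟨ cong₂ _*_ (cong (p ^_) ([∣]-yes (subst (_∣ p * m) (sym (*-identityʳ p)) (m∣m*n m)))) (∏-cong N′ λ j _ _ → cong (p ^_) (shift j)) ⟩
      p ^ 1 * ∏ N′ (λ j → p ^ [ p ^ j ∣ m ])                   ≡⟨ *-comm (p ^ 1) _ ⟩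
      ∏ N′ (λ j → p ^ [ p ^ j ∣ m ]) * p ^ 1                   ≡⟨ cong₂ _*_ last (*-identityʳ p) ⟩
      ∏ (suc N′) (λ j → p ^ [ p ^ j ∣ m ]) * p                 ∎
      where
      open ≡-Reasoning
      last : ∏ N′ (λ j → p ^ [ p ^ j ∣ m ]) ≡ ∏ (suc N′) (λ j → p ^ [ p ^ j ∣ m ])
      last = sym (trans (cong (λ e → ∏ N′ (λ j → p ^ [ p ^ j ∣ m ]) * p ^ e) ([∣]-no (subst (λ n → ¬ p ^ n ∣ m) (sym eqN) (p^∤ m pp 1≤m m≤N)))) (*-identityʳ _))

  Divisors : ℕ → Set
  Divisors n = 1 ≤ n → n ≤ N → n ≡ ⟦ (λ q → [ q ∣ n ]) ⟧

  -- The identity log n = Σ Λ(q) over the divisors q of n, obtained by splitting off one prime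
  -- factor at a time.
  divisor-product : ∀ n → Divisors n
  divisor-product = <-rec Divisors step
    where
    step : ∀ n → (∀ {m} → m < n → Divisors m) → Divisors n
    step 1 rec _ _ = sym (∏-ones N λ p _ _ → ∏-ones N λ j 1≤j _ → lem p j 1≤j)
      where
      lem : ∀ p j → 1 ≤ j → base p ^ [ p ^ j ∣ 1 ] ≡ 1
      lem p j 1≤j with prime? p
      ... | no _ = ^-zeroˡ [ p ^ j ∣ 1 ]
      ... | yes pp = cong (p ^_) ([∣]-no (nope j 1≤j))
        where
        nope : ∀ j → 1 ≤ j → ¬ p ^ j ∣ 1
        nope (suc j) _ d = contradiction pp (subst (¬_ ∘ Prime) (sym (∣1⇒≡1 (∣-trans (m∣m*n (p ^ j)) d))) ¬prime[1])
    step n@(suc (suc _)) rec 1≤n n≤N with ∃-primeDivisor n (s≤s (s≤s z≤n))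
    ... | p₀ , pp₀ , divides zero ()
    ... | p₀ , pp₀ , divides m@(suc _) eq = begin
      n                                        ≡⟨ eq ⟩
      m * p₀                                   ≡⟨ cong₂ _*_ (rec m<n z<s m≤N) (sym (∏-pick p₀ N 1≤p₀ (≤-trans p₀≤n n≤N))) ⟩
      ⟦ (λ q → [ q ∣ m ]) ⟧ * ∏ N (pick p₀)     ≡⟨ ∏-distrib-* N _ _ ⟨
      ∏ N (λ p → (∏ N λ j → base p ^ [ p ^ j ∣ m ]) * pick p₀ p) ≡⟨ ∏-cong N (λ p _ _ → factor-step p₀ m pp₀ z<s m≤N p) ⟨
      ⟦ (λ q → [ q ∣ p₀ * m ]) ⟧               ≡⟨ cong (λ k → ⟦ (λ q → [ q ∣ k ]) ⟧) (trans (*-comm p₀ m) (sym eq)) ⟩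
      ⟦ (λ q → [ q ∣ n ]) ⟧                    ∎
      where
      open ≡-Reasoning
      2≤p₀ : 2 ≤ p₀
      2≤p₀ = nonTrivial⇒n>1 p₀ {{prime⇒nonTrivial pp₀}}
      1≤p₀ = <-trans z<s 2≤p₀
      m<n : m < n
      m<n = subst (m <_) (sym eq) (m<m*n m p₀ 2≤p₀)
      m≤N = ≤-trans (<⇒≤ m<n) n≤N
      p₀≤n : p₀ ≤ n
      p₀≤n = subst (p₀ ≤_) (sym eq) (m≤n*m p₀ m)

  -- The product of `divisor-product` over 1, ..., n: the divisor q occurs once for each of its n ÷
  -- q multiples.
  legendre : ∀ n → n ≤ N → n ! ≡ ⟦ (λ q → n ÷ q) ⟧
  legendre zero    _   = sym (trans (⟦⟧-cong {_} {λ _ → 0} h) ⟦0⟧)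
    where
    h : ∀ q → 1 ≤ q → 0 ÷ q ≡ 0
    h (suc q) _ = 0/n≡0 (suc q)
  legendre (suc n) n≤N = begin
    suc n * n !                                        ≡⟨ *-comm (suc n) (n !) ⟩
    n ! * suc n                                        ≡⟨ cong₂ _*_ (legendre n (<⇒≤ n≤N)) (divisor-product (suc n) z<s n≤N) ⟩
    ⟦ (λ q → n ÷ q) ⟧ * ⟦ (λ q → [ q ∣ suc n ]) ⟧       ≡⟨ ⟦⟧-+ (λ q → n ÷ q) (λ q → [ q ∣ suc n ]) ⟨
    ⟦ (λ q → n ÷ q + [ q ∣ suc n ]) ⟧                   ≡⟨ ⟦⟧-cong (λ q 1≤q → suc-÷ n q 1≤q) ⟨
    ⟦ (λ q → suc n ÷ q) ⟧                              ∎
    where open ≡-Reasoning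

-- Factorials compared with powers

[a+b]!≤a![a+b]^b : ∀ a b → (a + b) ! ≤ a ! * (a + b) ^ b
[a+b]!≤a![a+b]^b a zero    = ≤-reflexive (trans (cong _! (+-identityʳ a)) (sym (*-identityʳ (a !))))
[a+b]!≤a![a+b]^b a (suc b) = begin
  (a + suc b) !                               ≡⟨ cong _! (+-suc a b) ⟩
  suc (a + b) * (a + b) !                     ≤⟨ *-monoʳ-≤ (suc (a + b)) ([a+b]!≤a![a+b]^b a b) ⟩
  suc (a + b) * (a ! * (a + b) ^ b)           ≤⟨ *-monoʳ-≤ (suc (a + b)) (*-monoʳ-≤ (a !) (^-monoˡ-≤ b (n≤1+n (a + b)))) ⟩
  suc (a + b) * (a ! * suc (a + b) ^ b)       ≡⟨ shift-in (suc (a + b)) (a !) (suc (a + b) ^ b) ⟩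
  a ! * suc (a + b) ^ suc b                   ≡⟨ cong (λ k → a ! * k ^ suc b) (+-suc a b) ⟨
  a ! * (a + suc b) ^ suc b                   ∎
  where
  open ≤-Reasoning
  shift-in : ∀ x y z → x * (y * z) ≡ y * (x * z)
  shift-in = solve-∀

a!a^b≤[a+b]! : ∀ a b → a ! * a ^ b ≤ (a + b) !
a!a^b≤[a+b]! a zero    = ≤-reflexive (trans (*-identityʳ (a !)) (sym (cong _! (+-identityʳ a))))
a!a^b≤[a+b]! a (suc b) = begin
  a ! * (a * a ^ b)       ≡⟨ shift-in (a !) a (a ^ b) ⟩
  a * (a ! * a ^ b)       ≤⟨ *-mono-≤ (m≤n⇒m≤1+n (m≤m+n a b)) (a!a^b≤[a+b]! a b) ⟩
  suc (a + b) * (a + b) ! ≡⟨ cong _! (+-suc a b) ⟨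
  (a + suc b) !           ∎
  where
  open ≤-Reasoning
  shift-in : ∀ x y z → x * (y * z) ≡ y * (x * z)
  shift-in = solve-∀

!-mono-≤ : ∀ {m n} → m ≤ n → m ! ≤ n !
!-mono-≤ {m} {n} m≤n = subst (λ k → m ! ≤ k !) (m+[n∸m]≡n m≤n) (go (n ∸ m))
  where
  go : ∀ k → m ! ≤ (m + k) !
  go zero    = ≤-reflexive (cong _! (sym (+-identityʳ m)))
  go (suc k) = ≤-trans (go k) (≤-trans (m≤m+n ((m + k) !) _) (≤-reflexive (cong _! (sym (+-suc m k)))))

-- The growth factor is the D-th power of the largest of the D new factors of (D * suc t) !, which
-- makes the comparison proceed block by block.
block-step : ∀ D t → D ^ (D * suc t) * (suc t !) ^ D ≡ D ^ (D * t) * (t !) ^ D * (D * suc t) ^ D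
block-step D t = begin
  D ^ (D * suc t) * (suc t * t !) ^ D               ≡⟨ cong₂ _*_ (cong (D ^_) (trans (*-suc D t) (+-comm D (D * t)))) (^-distribʳ-* (suc t) (t !) D) ⟩
  D ^ (D * t + D) * (suc t ^ D * (t !) ^ D)           ≡⟨ cong (_* (suc t ^ D * (t !) ^ D)) (^-distribˡ-+-* D (D * t) D) ⟩
  D ^ (D * t) * D ^ D * (suc t ^ D * (t !) ^ D)       ≡⟨ shuffle (D ^ (D * t)) (D ^ D) (suc t ^ D) ((t !) ^ D) ⟩
  D ^ (D * t) * (t !) ^ D * (D ^ D * suc t ^ D)       ≡⟨ cong (D ^ (D * t) * (t !) ^ D *_) (^-distribʳ-* D (suc t) D) ⟨
  D ^ (D * t) * (t !) ^ D * (D * suc t) ^ D         ∎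
  where
  open ≡-Reasoning
  shuffle : ∀ a b c d → a * b * (c * d) ≡ a * d * (b * c)
  shuffle = solve-∀

[D*t]!≤ : ∀ D t → (D * t) ! ≤ D ^ (D * t) * (t !) ^ D
[D*t]!≤ D zero    rewrite *-zeroʳ D = ≤-reflexive (sym (trans (+-identityʳ _) (^-zeroˡ D)))
[D*t]!≤ D (suc t) = begin
  (D * suc t) !                                ≡⟨ cong _! D*suc ⟩
  (D * t + D) !                                ≤⟨ [a+b]!≤a![a+b]^b (D * t) D ⟩
  (D * t) ! * (D * t + D) ^ D                  ≡⟨ cong (λ k → (D * t) ! * k ^ D) D*suc ⟨
  (D * t) ! * (D * suc t) ^ D                  ≤⟨ *-monoˡ-≤ ((D * suc t) ^ D) ([D*t]!≤ D t) ⟩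
  D ^ (D * t) * (t !) ^ D * (D * suc t) ^ D    ≡⟨ block-step D t ⟨
  D ^ (D * suc t) * (suc t !) ^ D              ∎
  where
  open ≤-Reasoning
  D*suc = trans (*-suc D t) (+-comm D (D * t))

-- The new factors exceed the maximum of the preceding block, so each block of the factorial is
-- compared with the power one block earlier. The last power is left over on the right.
≤[D*t]! : ∀ D t → 1 ≤ D → D ^ (D * suc t) * (suc t !) ^ D ≤ (D * suc t) ! * (D * suc t) ^ D
≤[D*t]! D zero 1≤D = begin
  D ^ (D * 1) * (1 !) ^ D          ≡⟨ cong₂ _*_ (cong (D ^_) (*-identityʳ D)) (^-zeroˡ D) ⟩
  D ^ D * 1                        ≡⟨ *-comm (D ^ D) 1 ⟩
  1 * D ^ D                        ≤⟨ *-monoˡ-≤ (D ^ D) (>-nonZero⁻¹ ((D * 1) !) {{_!≢0 (D * 1)}}) ⟩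
  (D * 1) ! * D ^ D                ≡⟨ cong (λ k → (D * 1) ! * k ^ D) (*-identityʳ D) ⟨
  (D * 1) ! * (D * 1) ^ D          ∎
  where open ≤-Reasoning
≤[D*t]! D (suc t) 1≤D = begin
  D ^ (D * suc (suc t)) * (suc (suc t) !) ^ D                      ≡⟨ block-step D (suc t) ⟩
  D ^ (D * suc t) * (suc t !) ^ D * (D * suc (suc t)) ^ D          ≤⟨ *-monoˡ-≤ ((D * suc (suc t)) ^ D) (≤[D*t]! D t 1≤D) ⟩
  (D * suc t) ! * (D * suc t) ^ D * (D * suc (suc t)) ^ D          ≤⟨ *-monoˡ-≤ ((D * suc (suc t)) ^ D) (a!a^b≤[a+b]! (D * suc t) D) ⟩
  (D * suc t + D) ! * (D * suc (suc t)) ^ D                        ≡⟨ cong (λ k → k ! * (D * suc (suc t)) ^ D) (trans (*-suc D (suc t)) (+-comm D (D * suc t))) ⟨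
  (D * suc (suc t)) ! * (D * suc (suc t)) ^ D                      ∎
  where open ≤-Reasoning

1≤^ : ∀ {z} n → 1 ≤ z → 1 ≤ z ^ n
1≤^ {z} n 1≤z = m^n>0 z {{>-nonZero 1≤z}} n

÷-split : ∀ x D → 1 ≤ D → ∃ λ r → x ≡ D * (x ÷ D) + r × r < D
÷-split x D@(suc _) _ = x % D , trans (m≡m%n+[m/n]*n x D) (trans (+-comm (x % D) _) (cong (_+ x % D) (*-comm (x / D) D))) , m%n<n x D

-- With t = ⌊x/D⌋, x! and D^x (t!)^D agree up to a power of x; this replaces Stirling's formula.
multinomial-≤ : ∀ x d z → x ≤ z → 1 ≤ z → x ! ≤ suc d ^ x * ((x ÷ suc d) !) ^ suc d * z ^ d
multinomial-≤ x d z x≤z 1≤z with ÷-split x (suc d) (s≤s z≤n)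
... | r , eq , r<D = begin
  x !                                               ≡⟨ cong _! eq ⟩
  (D * t + r) !                                     ≤⟨ [a+b]!≤a![a+b]^b (D * t) r ⟩
  (D * t) ! * (D * t + r) ^ r                       ≡⟨ cong (λ k → (D * t) ! * k ^ r) eq ⟨
  (D * t) ! * x ^ r                                 ≤⟨ *-mono-≤ ([D*t]!≤ D t) (≤-trans (^-monoˡ-≤ r x≤z) (^-monoʳ-≤ z {{>-nonZero 1≤z}} (≤-pred r<D))) ⟩
  D ^ (D * t) * (t !) ^ D * z ^ d                   ≤⟨ *-monoˡ-≤ (z ^ d) (*-monoˡ-≤ ((t !) ^ D) (^-monoʳ-≤ D (subst (D * t ≤_) (sym eq) (m≤m+n (D * t) r)))) ⟩
  D ^ x * (t !) ^ D * z ^ d                         ∎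
  where
  open ≤-Reasoning
  D = suc d
  t = x ÷ D

-- One z ^ D pays for the block left over in `≤[D*t]!`, the other for D ^ r, where r is the
-- remainder of x modulo D.
≤-multinomial : ∀ x D z → 1 ≤ D → x ≤ z → D ≤ z → D ^ x * ((x ÷ D) !) ^ D ≤ x ! * z ^ (D + D)
≤-multinomial x D z 1≤D x≤z D≤z with ÷-split x D 1≤D
... | r , eq , r<D = begin
  D ^ x * (t !) ^ D                                 ≡⟨ cong (λ k → D ^ k * (t !) ^ D) eq ⟩
  D ^ (D * t + r) * (t !) ^ D                       ≡⟨ cong (_* (t !) ^ D) (^-distribˡ-+-* D (D * t) r) ⟩
  D ^ (D * t) * D ^ r * (t !) ^ D                   ≡⟨ rearr (D ^ (D * t)) (D ^ r) ((t !) ^ D) ⟩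
  D ^ (D * t) * (t !) ^ D * D ^ r                   ≤⟨ *-mono-≤ (core t refl) (≤-trans (^-monoˡ-≤ r D≤z) (^-monoʳ-≤ z {{>-nonZero 1≤z}} (<⇒≤ r<D))) ⟩
  x ! * z ^ D * z ^ D                               ≡⟨ *-assoc (x !) (z ^ D) (z ^ D) ⟩
  x ! * (z ^ D * z ^ D)                             ≡⟨ cong (x ! *_) (^-distribˡ-+-* z D D) ⟨
  x ! * z ^ (D + D)                                 ∎
  where
  open ≤-Reasoning
  t = x ÷ D
  1≤z = ≤-trans 1≤D D≤z
  Dt≤x : D * t ≤ x
  Dt≤x = n*[m÷n]≤m x D
  rearr : ∀ a b c → a * b * c ≡ a * c * b
  rearr = solve-∀
  core : ∀ s → s ≡ t → D ^ (D * s) * (s !) ^ D ≤ x ! * z ^ D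
  core zero    _ = begin
    D ^ (D * 0) * 1 ^ D   ≡⟨ cong₂ _*_ (cong (D ^_) (*-zeroʳ D)) (^-zeroˡ D) ⟩
    1                     ≤⟨ *-mono-≤ (>-nonZero⁻¹ (x !) {{_!≢0 x}}) (1≤^ D 1≤z) ⟩
    x ! * z ^ D           ∎
  core (suc s) s≡t = ≤-trans (≤[D*t]! D s 1≤D) (*-mono-≤ (!-mono-≤ Ds≤x) (^-monoˡ-≤ D (≤-trans Ds≤x x≤z)))
    where
    Ds≤x : D * suc s ≤ x
    Ds≤x = subst (λ k → D * k ≤ x) (sym s≡t) Dt≤x

-- Linear combinations of logarithms of factorials

-- fac D m a stands for m D log ⌊x/D⌋!, where a/Q approximates the binary logarithm of D.
-- The coefficient is a multiple of D so that the leading terms of a combination cancel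
-- exactly when its multipliers m cancel.
record Fac : Set where
  constructor fac
  field
    den mul lg : ℕ

-- stp T r stands for r T ψ(x/T).
record Step : Set where
  constructor stp
  field
    thr mul : ℕ

∑ : {A : Set} → (A → ℕ) → List A → ℕ
∑ f []       = 0
∑ f (x ∷ xs) = f x + ∑ f xs

facMul facLog facTot : Fac → ℕ
facMul (fac D m a) = m
facLog (fac D m a) = m * a
facTot (fac D m a) = m * D

facVal : ℕ → Fac → ℕ
facVal W (fac D m a) = m * D * (W ÷ D)

stpMul stpTot : Step → ℕ
stpMul (stp T r) = r
stpTot (stp T r) = r * T

stpVal : ℕ → Step → ℕ
stpVal W (stp T r) = r * T * (1 ⊓ (W ÷ T))

-- The inequality lhs W ≤ rhs W, weighted by Λ(q) at W = ⌊x/q⌋ and summed over q, reads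
--   Σ facˡ + target ψ(x) ≤ Σ facʳ + Σ steps + tail + excess Σ Λ(q),
-- the last sum over the prime powers q with ⌊x/q⌋ between gridˡ and gridʳ - 1.
record Functional : Set where
  constructor functional
  field
    gridˡ gridʳ    : ℕ
    facˡ facʳ      : List Fac
    steps          : List Step
    tail           : Step
    target excess  : ℕ

  hit : ℕ → ℕ
  hit W = 1 ⊓ (W ÷ gridˡ) ∸ (W ÷ gridʳ)

  lhs rhs : ℕ → ℕ
  lhs W = ∑ (facVal W) facˡ + target * (1 ⊓ W)
  rhs W = ∑ (facVal W) facʳ + ∑ (stpVal W) steps + ∑ (stpVal W) (tail ∷ []) + excess * hit W

-- Chebyshev-type estimates

m≤n*[m÷n]+n : ∀ m n → 1 ≤ n → m ≤ n * (m ÷ n) + n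
m≤n*[m÷n]+n m n 1≤n with ÷-split m n 1≤n
... | r , eq , r<n = subst (_≤ n * (m ÷ n) + n) (sym eq) (+-monoʳ-≤ (n * (m ÷ n)) (<⇒≤ r<n))

0÷ : ∀ D → 0 ÷ D ≡ 0
0÷ zero    = refl
0÷ (suc D) = 0/n≡0 (suc D)

÷≥1 : ∀ {m n} → 1 ≤ n → n ≤ m → 1 ≤ m ÷ n
÷≥1 {m} {suc n} _ n≤m = m≥n⇒m/n>0 n≤m

^-cancelʳ-≤ : ∀ a b p → 1 ≤ p → a ^ p ≤ b ^ p → a ≤ b
^-cancelʳ-≤ a b p 1≤p a^p≤b^p = ≮⇒≥ λ b<a → <⇒≱ (^-monoˡ-< p {{>-nonZero 1≤p}} b<a) a^p≤b^p

-- A linear combination of inequalities between logarithms, with log X cancelled.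
combine : ∀ X F F′ S T L L′ V P R Za Zb Zu →
  1 ≤ X →
  F * P ≤ F′ * S * T * R →
  X ≤ F * L * Za →
  F′ * L′ ≤ X * Zb →
  S * T ≤ V * Zu →
  L′ * P ≤ L * V * R * (Za * Zb * Zu)
combine X F F′ S T L L′ V P R Za Zb Zu 1≤X h a b d =
  *-cancelˡ-≤ X {{>-nonZero 1≤X}} (begin
    X * (L′ * P)                         ≤⟨ *-monoˡ-≤ (L′ * P) a ⟩
    F * L * Za * (L′ * P)                ≡⟨ r₁ F L Za L′ P ⟩
    F * P * (L * L′ * Za)                ≤⟨ *-monoˡ-≤ _ h ⟩
    F′ * S * T * R * (L * L′ * Za)       ≡⟨ r₂ F′ S T R L L′ Za ⟩
    F′ * L′ * (S * T) * (R * L * Za)     ≤⟨ *-monoˡ-≤ _ (*-mono-≤ b d) ⟩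
    X * Zb * (V * Zu) * (R * L * Za)     ≡⟨ r₃ X Zb V Zu R L Za ⟩
    X * (L * V * R * (Za * Zb * Zu))     ∎)
  where
  open ≤-Reasoning
  r₁ : ∀ F L Za L′ P → F * L * Za * (L′ * P) ≡ F * P * (L * L′ * Za)
  r₁ = solve-∀
  r₂ : ∀ F′ S T R L L′ Z → F′ * S * T * R * (L * L′ * Z) ≡ F′ * L′ * (S * T) * (R * L * Z)
  r₂ = solve-∀
  r₃ : ∀ X Zb V Zu R L Za → X * Zb * (V * Zu) * (R * L * Za) ≡ X * (L * V * R * (Za * Zb * Zu))
  r₃ = solve-∀

LowerLog UpperLog : ℕ → Fac → Set
LowerLog Q (fac D m a) = 1 ≤ D × 2 ^ a ≤ D ^ Q
UpperLog Q (fac D m a) = 1 ≤ D × D ^ Q ≤ 2 ^ a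

DenBound : ℕ → Fac → Set
DenBound N (fac D m a) = D ≤ N

record Valid (Q : ℕ) (f : Functional) : Set where
  open Functional f
  field
    balanced : ∑ facMul facˡ ≡ ∑ facMul facʳ
    logˡ     : All (UpperLog Q) facˡ
    logʳ     : All (LowerLog Q) facʳ
    lhs≤rhs  : ∀ W → lhs W ≤ rhs W

module Estimates (N Q : ℕ) (2≤N : 2 ≤ N) where
  open Weights N

  1≤N : 1 ≤ N
  1≤N = <⇒≤ 2≤N

  -- log (Ψ x) is Chebyshev's ψ(x), for x ≤ N.
  Ψ : ℕ → ℕ
  Ψ x = ⟦ (λ q → 1 ⊓ (x ÷ q)) ⟧

  ÷≤N : ∀ {x} D → x ≤ N → x ÷ D ≤ N
  ÷≤N {x} D x≤N = ≤-trans (m÷n≤m x D) x≤N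

  ⟦∑⟧-∷ : ∀ {A : Set} (v : ℕ → A → ℕ) x a as → 
    ⟦ (λ q → ∑ (v (x ÷ q)) (a ∷ as)) ⟧ ≡ ⟦ (λ q → v (x ÷ q) a) ⟧ * ⟦ (λ q → ∑ (v (x ÷ q)) as) ⟧
  ⟦∑⟧-∷ v x a as = ⟦⟧-+ (λ q → v (x ÷ q) a) (λ q → ∑ (v (x ÷ q)) as)

  ⟦facVal⟧ : ∀ {x} → x ≤ N → ∀ D m a → ⟦ (λ q → facVal (x ÷ q) (fac D m a)) ⟧ ≡ ((x ÷ D) !) ^ (m * D)
  ⟦facVal⟧ {x} x≤N D m a = trans (⟦⟧-* (m * D) (λ q → x ÷ q ÷ D)) (cong (_^ (m * D))
    (trans (⟦⟧-cong λ q _ → ÷-÷-comm x q D) (sym (legendre (x ÷ D) (÷≤N D x≤N)))))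

  ⟦stpVal⟧ : ∀ x T r → ⟦ (λ q → stpVal (x ÷ q) (stp T r)) ⟧ ≡ Ψ (x ÷ T) ^ (r * T)
  ⟦stpVal⟧ x T r = trans (⟦⟧-* (r * T) (λ q → 1 ⊓ (x ÷ q ÷ T))) (cong (_^ (r * T))
    (⟦⟧-cong λ q _ → cong (1 ⊓_) (÷-÷-comm x q T)))

  facProd : ℕ → List Fac → ℕ
  facProd x L = ⟦ (λ q → ∑ (facVal (x ÷ q)) L) ⟧

  stpProd : ℕ → List Step → ℕ
  stpProd x L = ⟦ (λ q → ∑ (stpVal (x ÷ q)) L) ⟧

  ^-regroup : ∀ b m D → (b ^ (m * D)) ^ Q ≡ (b ^ D) ^ (m * Q)
  ^-regroup b m D = begin
    (b ^ (m * D)) ^ Q   ≡⟨ ^-*-assoc b (m * D) Q ⟩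
    b ^ (m * D * Q)     ≡⟨ cong (b ^_) (e m D Q) ⟩
    b ^ (D * (m * Q))   ≡⟨ ^-*-assoc b D (m * Q) ⟨
    (b ^ D) ^ (m * Q)   ∎
    where
    open ≡-Reasoning
    e : ∀ m D Q → m * D * Q ≡ D * (m * Q)
    e = solve-∀

  log-regroup : ∀ b x m Q → (b ^ Q) ^ (x * m) ≡ (b ^ x) ^ (m * Q)
  log-regroup b x m Q = trans (^-*-assoc b Q (x * m)) (trans (cong (b ^_) (e x m Q)) (sym (^-*-assoc b x (m * Q))))
    where
    e : ∀ x m Q → Q * (x * m) ≡ x * (m * Q)
    e = solve-∀

  2^-split : ∀ x m a S → 2 ^ (x * (m * a + S)) ≡ (2 ^ a) ^ (x * m) * 2 ^ (x * S)
  2^-split x m a S = trans (cong (2 ^_) (e x m a S)) (trans (^-distribˡ-+-* 2 (a * (x * m)) (x * S)) (cong (_* 2 ^ (x * S)) (sym (^-*-assoc 2 a (x * m)))))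
    where
    e : ∀ x m a S → x * (m * a + S) ≡ a * (x * m) + x * S
    e = solve-∀

  ^-split : ∀ z m Q S → z ^ (Q * (m + S)) ≡ z ^ (m * Q) * z ^ (Q * S)
  ^-split z m Q S = trans (cong (z ^_) (e m Q S)) (^-distribˡ-+-* z (m * Q) (Q * S))
    where
    e : ∀ m Q S → Q * (m + S) ≡ m * Q + Q * S
    e = solve-∀

  -- Each term satisfies m D log ⌊x/D⌋! ≤ m log x! - m x log D + 2 m D log N. The Q-th power makes
  -- room for a/Q in place of log D, which enters negatively here, so a must be rounded down.
  facProd-upper : ∀ {x} → x ≤ N → ∀ L → All (LowerLog Q) L → All (DenBound N) L →
    facProd x L ^ Q * 2 ^ (x * ∑ facLog L) ≤ (x !) ^ (Q * ∑ facMul L) * N ^ (Q * (∑ facTot L + ∑ facTot L))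
  facProd-upper {x} x≤N [] _ _ = ≤-reflexive (cong₂ _*_ (trans (cong (_^ Q) ⟦0⟧) (trans (^-zeroˡ Q) (cong (x ! ^_) (sym (*-zeroʳ Q)))))
     (trans (cong (2 ^_) (*-zeroʳ x)) (cong (N ^_) (sym (*-zeroʳ Q)))))
  facProd-upper {x} x≤N (fac D m a ∷ L) ((1≤D , 2^a≤) ∷ lo) (D≤N ∷ db) = begin
    facProd x (fac D m a ∷ L) ^ Q * 2 ^ (x * (m * a + A))
      ≡⟨ cong₂ _*_ (cong (_^ Q) (trans (⟦∑⟧-∷ facVal x (fac D m a) L) (cong (_* facProd x L) (⟦facVal⟧ x≤N D m a)))) (2^-split x m a A) ⟩
    (t ^ (m * D) * facProd x L) ^ Q * ((2 ^ a) ^ (x * m) * 2 ^ (x * A))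
      ≡⟨ cong (_* ((2 ^ a) ^ (x * m) * 2 ^ (x * A))) (trans (^-distribʳ-* (t ^ (m * D)) (facProd x L) Q) (cong (_* facProd x L ^ Q) (^-regroup t m D))) ⟩
    (t ^ D) ^ (m * Q) * facProd x L ^ Q * ((2 ^ a) ^ (x * m) * 2 ^ (x * A))
      ≤⟨ *-monoʳ-≤ ((t ^ D) ^ (m * Q) * facProd x L ^ Q) (*-monoˡ-≤ (2 ^ (x * A)) (^-monoˡ-≤ (x * m) 2^a≤)) ⟩
    (t ^ D) ^ (m * Q) * facProd x L ^ Q * ((D ^ Q) ^ (x * m) * 2 ^ (x * A))
      ≡⟨ cong (λ k → (t ^ D) ^ (m * Q) * facProd x L ^ Q * (k * 2 ^ (x * A))) (log-regroup D x m Q) ⟩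
    (t ^ D) ^ (m * Q) * facProd x L ^ Q * ((D ^ x) ^ (m * Q) * 2 ^ (x * A))
      ≡⟨ rearr₁ ((t ^ D) ^ (m * Q)) (facProd x L ^ Q) ((D ^ x) ^ (m * Q)) (2 ^ (x * A)) ⟩
    (D ^ x) ^ (m * Q) * (t ^ D) ^ (m * Q) * (facProd x L ^ Q * 2 ^ (x * A))
      ≡⟨ cong (_* (facProd x L ^ Q * 2 ^ (x * A))) (^-distribʳ-* (D ^ x) (t ^ D) (m * Q)) ⟨
    (D ^ x * t ^ D) ^ (m * Q) * (facProd x L ^ Q * 2 ^ (x * A))
      ≤⟨ *-mono-≤ (^-monoˡ-≤ (m * Q) (≤-multinomial x D N 1≤D x≤N D≤N)) (facProd-upper x≤N L lo db) ⟩
    (x ! * N ^ (D + D)) ^ (m * Q) * ((x !) ^ (Q * M) * N ^ (Q * (C + C)))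
      ≡⟨ cong (_* ((x !) ^ (Q * M) * N ^ (Q * (C + C)))) (trans (^-distribʳ-* (x !) (N ^ (D + D)) (m * Q)) (cong ((x !) ^ (m * Q) *_) (^-*-assoc N (D + D) (m * Q)))) ⟩
    (x !) ^ (m * Q) * N ^ ((D + D) * (m * Q)) * ((x !) ^ (Q * M) * N ^ (Q * (C + C)))
      ≡⟨ [m*n]*[o*p]≡[m*o]*[n*p] ((x !) ^ (m * Q)) (N ^ ((D + D) * (m * Q))) ((x !) ^ (Q * M)) (N ^ (Q * (C + C))) ⟩
    (x !) ^ (m * Q) * (x !) ^ (Q * M) * (N ^ ((D + D) * (m * Q)) * N ^ (Q * (C + C)))
      ≡⟨ cong₂ _*_ (sym (^-split (x !) m Q M)) (trans (sym (^-distribˡ-+-* N ((D + D) * (m * Q)) (Q * (C + C)))) (cong (N ^_) (rearr₂ D m Q C))) ⟩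
    (x !) ^ (Q * (m + M)) * N ^ (Q * (m * D + C + (m * D + C))) ∎
    where
    open ≤-Reasoning
    t = (x ÷ D) !
    A = ∑ facLog L
    M = ∑ facMul L
    C = ∑ facTot L
    rearr₁ : ∀ a b c d → a * b * (c * d) ≡ c * a * (b * d)
    rearr₁ = solve-∀
    rearr₂ : ∀ D m Q C → (D + D) * (m * Q) + Q * (C + C) ≡ Q * (m * D + C + (m * D + C))
    rearr₂ = solve-∀

  facProd-lower : ∀ {x} → x ≤ N → ∀ L → All (UpperLog Q) L →
    (x !) ^ (Q * ∑ facMul L) ≤ facProd x L ^ Q * 2 ^ (x * ∑ facLog L) * N ^ (Q * ∑ facTot L)
  facProd-lower {x} x≤N [] _ = ≤-reflexive (trans (cong (x ! ^_) (*-zeroʳ Q)) (sym (cong₂ _*_ (cong₂ _*_ (trans (cong (_^ Q) ⟦0⟧) (^-zeroˡ Q)) (cong (2 ^_) (*-zeroʳ x))) (cong (N ^_) (*-zeroʳ Q)))))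
  facProd-lower {x} x≤N (fac zero m a ∷ L) ((() , _) ∷ up)
  facProd-lower {x} x≤N (fac D@(suc d) m a ∷ L) ((1≤D , ≤2^a) ∷ up) = begin
    (x !) ^ (Q * (m + M))                      ≡⟨ ^-split (x !) m Q M ⟩
    (x !) ^ (m * Q) * (x !) ^ (Q * M)
      ≤⟨ *-mono-≤ (^-monoˡ-≤ (m * Q) (multinomial-≤ x d N x≤N 1≤N)) (facProd-lower x≤N L up) ⟩
    (D ^ x * t ^ D * N ^ d) ^ (m * Q) * (facProd x L ^ Q * 2 ^ (x * A) * N ^ (Q * C))
      ≡⟨ cong (_* (facProd x L ^ Q * 2 ^ (x * A) * N ^ (Q * C))) (trans (^-distribʳ-* (D ^ x * t ^ D) (N ^ d) (m * Q))
           (cong₂ _*_ (trans (^-distribʳ-* (D ^ x) (t ^ D) (m * Q)) (cong₂ _*_ (sym (log-regroup D x m Q)) (sym (^-regroup t m D)))) (^-*-assoc N d (m * Q)))) ⟩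
    (D ^ Q) ^ (x * m) * (t ^ (m * D)) ^ Q * N ^ (d * (m * Q)) * (facProd x L ^ Q * 2 ^ (x * A) * N ^ (Q * C))
      ≤⟨ *-monoˡ-≤ _ (*-mono-≤ (*-monoˡ-≤ ((t ^ (m * D)) ^ Q) (^-monoˡ-≤ (x * m) ≤2^a)) (^-monoʳ-≤ N {{>-nonZero 1≤N}} (*-monoˡ-≤ (m * Q) (n≤1+n d)))) ⟩
    (2 ^ a) ^ (x * m) * (t ^ (m * D)) ^ Q * N ^ (D * (m * Q)) * (facProd x L ^ Q * 2 ^ (x * A) * N ^ (Q * C))
      ≡⟨ rearr₁ ((2 ^ a) ^ (x * m)) ((t ^ (m * D)) ^ Q) (N ^ (D * (m * Q))) (facProd x L ^ Q) (2 ^ (x * A)) (N ^ (Q * C)) ⟩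
    (t ^ (m * D)) ^ Q * facProd x L ^ Q * ((2 ^ a) ^ (x * m) * 2 ^ (x * A)) * (N ^ (D * (m * Q)) * N ^ (Q * C))
      ≡⟨ cong₂ _*_ (cong₂ _*_ (trans (sym (^-distribʳ-* (t ^ (m * D)) (facProd x L) Q)) (cong (_^ Q) (sym (trans (⟦∑⟧-∷ facVal x (fac D m a) L) (cong (_* facProd x L) (⟦facVal⟧ x≤N D m a)))))) (sym (2^-split x m a A)))
                   (trans (sym (^-distribˡ-+-* N (D * (m * Q)) (Q * C))) (cong (N ^_) (rearr₂ D m Q C))) ⟩
    facProd x (fac D m a ∷ L) ^ Q * 2 ^ (x * (m * a + A)) * N ^ (Q * (m * D + C)) ∎
    where
    open ≤-Reasoning
    t = (x ÷ D) !
    A = ∑ facLog L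
    M = ∑ facMul L
    C = ∑ facTot L
    rearr₁ : ∀ a b c d e f → a * b * c * (d * e * f) ≡ b * d * (a * e) * (c * f)
    rearr₁ = solve-∀
    rearr₂ : ∀ D m Q C → D * (m * Q) + Q * C ≡ Q * (m * D + C)
    rearr₂ = solve-∀

  -- ψ(x) ≤ (u/Q) x log 2 + (e/Q) log N
  record Upper (u e : ℕ) : Set where
    constructor upper
    field bound : ∀ {x} → x ≤ N → Ψ x ^ Q ≤ 2 ^ (u * x) * N ^ e

  ^^-swap : ∀ b m n → (b ^ m) ^ n ≡ (b ^ n) ^ m
  ^^-swap b m n = trans (^-*-assoc b m n) (trans (cong (b ^_) (*-comm m n)) (sym (^-*-assoc b n m)))

  -- The factor T in r T ψ(x/T) cancels against x/T, so a step costs r times the slope whatever its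
  -- threshold; T survives only in the error exponent.
  stpProd-upper : ∀ {u e} → Upper u e → ∀ {x} → x ≤ N → ∀ L →
    stpProd x L ^ Q ≤ 2 ^ (u * x * ∑ stpMul L) * N ^ (e * ∑ stpTot L)
  stpProd-upper {u} {e} up {x} x≤N [] = ≤-reflexive (trans (cong (_^ Q) ⟦0⟧) (trans (^-zeroˡ Q) (sym (cong₂ _*_ (cong (2 ^_) (*-zeroʳ (u * x))) (cong (N ^_) (*-zeroʳ e))))))
  stpProd-upper {u} {e} up {x} x≤N (stp T r ∷ L) = begin
    stpProd x (stp T r ∷ L) ^ Q
      ≡⟨ cong (_^ Q) (trans (⟦∑⟧-∷ stpVal x (stp T r) L) (cong (_* stpProd x L) (⟦stpVal⟧ x T r))) ⟩
    (Ψ (x ÷ T) ^ (r * T) * stpProd x L) ^ Q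
      ≡⟨ trans (^-distribʳ-* (Ψ (x ÷ T) ^ (r * T)) (stpProd x L) Q) (cong (_* stpProd x L ^ Q) (^^-swap (Ψ (x ÷ T)) (r * T) Q)) ⟩
    (Ψ (x ÷ T) ^ Q) ^ (r * T) * stpProd x L ^ Q
      ≤⟨ *-mono-≤ (^-monoˡ-≤ (r * T) (Upper.bound up (÷≤N T x≤N))) (stpProd-upper up x≤N L) ⟩
    (2 ^ (u * (x ÷ T)) * N ^ e) ^ (r * T) * (2 ^ (u * x * R) * N ^ (e * S))
      ≡⟨ cong (_* (2 ^ (u * x * R) * N ^ (e * S))) (trans (^-distribʳ-* (2 ^ (u * (x ÷ T))) (N ^ e) (r * T)) (cong₂ _*_ (^-*-assoc 2 (u * (x ÷ T)) (r * T)) (^-*-assoc N e (r * T)))) ⟩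
    2 ^ (u * (x ÷ T) * (r * T)) * N ^ (e * (r * T)) * (2 ^ (u * x * R) * N ^ (e * S))
      ≤⟨ *-monoˡ-≤ (2 ^ (u * x * R) * N ^ (e * S)) (*-monoˡ-≤ (N ^ (e * (r * T))) (^-monoʳ-≤ 2
           (≤-trans (≤-reflexive (e₁ u (x ÷ T) r T)) (≤-trans (*-monoʳ-≤ (u * r) (n*[m÷n]≤m x T)) (≤-reflexive (e₂ u r x)))))) ⟩
    2 ^ (u * x * r) * N ^ (e * (r * T)) * (2 ^ (u * x * R) * N ^ (e * S))
      ≡⟨ [m*n]*[o*p]≡[m*o]*[n*p] (2 ^ (u * x * r)) (N ^ (e * (r * T))) (2 ^ (u * x * R)) (N ^ (e * S)) ⟩
    2 ^ (u * x * r) * 2 ^ (u * x * R) * (N ^ (e * (r * T)) * N ^ (e * S))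
      ≡⟨ cong₂ _*_ (collect 2 (u * x) r R) (collect N e (r * T) S) ⟩
    2 ^ (u * x * (r + R)) * N ^ (e * (r * T + S)) ∎
    where
    open ≤-Reasoning
    R = ∑ stpMul L
    S = ∑ stpTot L
    collect : ∀ b k m n → b ^ (k * m) * b ^ (k * n) ≡ b ^ (k * (m + n))
    collect b k m n = trans (sym (^-distribˡ-+-* b (k * m) (k * n))) (cong (b ^_) (sym (*-distribˡ-+ k m n)))
    e₁ : ∀ u y r T → u * y * (r * T) ≡ u * r * (T * y)
    e₁ = solve-∀
    e₂ : ∀ u r x → u * r * x ≡ u * x * r
    e₂ = solve-∀

  -- Chebyshev's argument with x! / (⌊x/2⌋!)².
  Ψ≤16^ : ∀ {x} → x ≤ N → Ψ x ≤ 2 ^ (4 * x)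
  Ψ≤16^ {x} = <-rec (λ x → x ≤ N → Ψ x ≤ 2 ^ (4 * x)) step x
    where
    Ψ0≡1 : Ψ 0 ≡ 1
    Ψ0≡1 = trans (⟦⟧-cong {_} {λ _ → 0} λ q _ → cong (1 ⊓_) (0÷ q)) ⟦0⟧
    pointwise : ∀ W → 1 ⊓ W + 2 * (W ÷ 2) ≤ W + 1 ⊓ (W ÷ 2)
    pointwise zero          = z≤n
    pointwise (suc zero)    = ≤-refl
    pointwise W@(suc (suc _)) = ≤-trans (≤-reflexive (+-comm 1 (2 * (W ÷ 2))))
      (+-mono-≤ (n*[m÷n]≤m W 2) (⊓-glb ≤-refl (÷≥1 {W} {2} (s≤s z≤n) (s≤s (s≤s z≤n)))))
    step : ∀ x → (∀ {y} → y < x → y ≤ N → Ψ y ≤ 2 ^ (4 * y)) → x ≤ N → Ψ x ≤ 2 ^ (4 * x)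
    step zero      _   _   = ≤-reflexive Ψ0≡1
    step x@(suc _) rec x≤N = *-cancelʳ-≤ _ _ (((x ÷ 2) !) ^ 2) {{>-nonZero (1≤^ {(x ÷ 2) !} 2 (>-nonZero⁻¹ ((x ÷ 2) !) {{_!≢0 (x ÷ 2)}}))}} (begin
      Ψ x * ((x ÷ 2) !) ^ 2
        ≡⟨ cong (λ k → Ψ x * k ^ 2) (legendre h h≤N) ⟩
      Ψ x * ⟦ (λ q → h ÷ q) ⟧ ^ 2
        ≡⟨ cong (Ψ x *_) (trans (sym (⟦⟧-* 2 (λ q → h ÷ q))) (⟦⟧-cong λ q _ → cong (2 *_) (÷-÷-comm x 2 q))) ⟩
      Ψ x * ⟦ (λ q → 2 * (x ÷ q ÷ 2)) ⟧
        ≡⟨ ⟦⟧-+ (λ q → 1 ⊓ (x ÷ q)) (λ q → 2 * (x ÷ q ÷ 2)) ⟨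
      ⟦ (λ q → 1 ⊓ (x ÷ q) + 2 * (x ÷ q ÷ 2)) ⟧
        ≤⟨ ⟦⟧-mono-≤ (λ q _ → pointwise (x ÷ q)) ⟩
      ⟦ (λ q → x ÷ q + 1 ⊓ (x ÷ q ÷ 2)) ⟧
        ≡⟨ ⟦⟧-+ (λ q → x ÷ q) (λ q → 1 ⊓ (x ÷ q ÷ 2)) ⟩
      ⟦ (λ q → x ÷ q) ⟧ * ⟦ (λ q → 1 ⊓ (x ÷ q ÷ 2)) ⟧
        ≡⟨ cong₂ _*_ (sym (legendre x x≤N)) (⟦⟧-cong λ q _ → cong (1 ⊓_) (÷-÷-comm x q 2)) ⟩
      x ! * Ψ h
        ≤⟨ *-mono-≤ (multinomial-≤ x 1 x ≤-refl (s≤s z≤n)) (rec h<x h≤N) ⟩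
      2 ^ x * (h !) ^ 2 * x ^ 1 * 2 ^ (4 * h)
        -- The polynomial error x is bounded by another 2 ^ x. The exponents x + x + 2 * x then add
        -- up to 4 * x, the reason for the base 16.
        ≤⟨ *-mono-≤ (*-monoʳ-≤ (2 ^ x * (h !) ^ 2) (≤-trans (≤-reflexive (*-identityʳ x)) (<⇒≤ (n<m^n 2 x ≤-refl)))) (^-monoʳ-≤ 2 4h≤) ⟩
      2 ^ x * (h !) ^ 2 * 2 ^ x * 2 ^ (2 * x)
        ≡⟨ trans (rearr (2 ^ x) ((h !) ^ 2) (2 ^ (2 * x))) (cong (_* (h !) ^ 2) (trans (cong (_* 2 ^ (2 * x)) (sym (^-distribˡ-+-* 2 x x))) (trans (sym (^-distribˡ-+-* 2 (x + x) (2 * x))) (cong (2 ^_) (four x))))) ⟩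
      2 ^ (4 * x) * (h !) ^ 2 ∎)
      where
      open ≤-Reasoning
      h = x ÷ 2
      h≤N = ÷≤N 2 x≤N
      h<x : h < x
      h<x = m/n<m x 2 (s≤s (s≤s z≤n))
      4h≤ : 4 * h ≤ 2 * x
      4h≤ = ≤-trans (≤-reflexive (*-assoc 2 2 h)) (*-monoʳ-≤ 2 (n*[m÷n]≤m x 2))
      rearr : ∀ a b c → a * b * a * c ≡ a * a * c * b
      rearr = solve-∀
      four : ∀ x → x + x + 2 * x ≡ 4 * x
      four = solve-∀

  crude-upper : Upper (4 * Q) 0
  crude-upper = upper λ {x} x≤N → ≤-trans (^-monoˡ-≤ Q (Ψ≤16^ x≤N))
    (≤-reflexive (trans (^-*-assoc 2 (4 * x) Q) (trans (cong (2 ^_) (e x Q)) (sym (*-identityʳ _)))))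
    where
    e : ∀ x Q → 4 * x * Q ≡ 4 * Q * x
    e = solve-∀

  module _ (f : Functional) (valid : Valid Q f) (dens : All (DenBound N) (Functional.facʳ f))
           {u e v eᵥ : ℕ} (up : Upper u e) (tail-up : Upper v eᵥ) where
    open Functional f renaming (tail to tail₁)
    open Valid valid

    tail : List Step
    tail = tail₁ ∷ []

    Hits : ℕ → ℕ
    Hits x = ⟦ (λ q → hit (x ÷ q)) ⟧

    -- Up to errors, m D log ⌊x/D⌋! is m log x! - m x log D. The log x! cancel by `balanced`; what
    -- remains is linear in x, with `logLoss` and `logGain` as its coefficients in units of (log
    -- 2)/Q. `errorExp` collects the powers of N: D per unit of multiplier on the left, 2 D on the
    -- right, and those of the bounds for ψ.
    logLoss errorExp : ℕ
    logLoss = ∑ facLog facˡ + u * ∑ stpMul steps + v * ∑ stpMul tail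
    errorExp = Q * ∑ facTot facˡ + Q * (∑ facTot facʳ + ∑ facTot facʳ) + (e * ∑ stpTot steps + eᵥ * ∑ stpTot tail)

    logGain : ℕ
    logGain = ∑ facLog facʳ

    summed : ∀ {x} → x ≤ N →
      facProd x facˡ * Ψ x ^ target ≤ facProd x facʳ * stpProd x steps * stpProd x tail * Hits x ^ excess
    summed {x} x≤N = begin
      facProd x facˡ * Ψ x ^ target
        ≡⟨ cong (facProd x facˡ *_) (⟦⟧-* target (λ q → 1 ⊓ (x ÷ q))) ⟨
      facProd x facˡ * ⟦ (λ q → target * (1 ⊓ (x ÷ q))) ⟧
        ≡⟨ ⟦⟧-+ (λ q → ∑ (facVal (x ÷ q)) facˡ) (λ q → target * (1 ⊓ (x ÷ q))) ⟨
      ⟦ (λ q → lhs (x ÷ q)) ⟧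
        ≤⟨ ⟦⟧-mono-≤ (λ q _ → lhs≤rhs (x ÷ q)) ⟩
      ⟦ (λ q → rhs (x ÷ q)) ⟧
        ≡⟨ ⟦⟧-+ (λ q → g q + ∑ (stpVal (x ÷ q)) tail) (λ q → excess * hit (x ÷ q)) ⟩
      ⟦ (λ q → g q + ∑ (stpVal (x ÷ q)) tail) ⟧ * ⟦ (λ q → excess * hit (x ÷ q)) ⟧
        ≡⟨ cong₂ _*_ (trans (⟦⟧-+ g (λ q → ∑ (stpVal (x ÷ q)) tail)) (cong (_* stpProd x tail) (⟦⟧-+ (λ q → ∑ (facVal (x ÷ q)) facʳ) (λ q → ∑ (stpVal (x ÷ q)) steps))))
             (⟦⟧-* excess (λ q → hit (x ÷ q))) ⟩
      facProd x facʳ * stpProd x steps * stpProd x tail * Hits x ^ excess ∎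
      where
      open ≤-Reasoning
      g = λ q → ∑ (facVal (x ÷ q)) facʳ + ∑ (stpVal (x ÷ q)) steps

    estimate : ∀ {x} → x ≤ N →
      2 ^ (x * logGain) * (Ψ x ^ Q) ^ target ≤ 2 ^ (x * logLoss) * (Hits x ^ excess) ^ Q * N ^ errorExp
    estimate {x} x≤N = begin
      2 ^ (x * logGain) * (Ψ x ^ Q) ^ target
        ≡⟨ cong (2 ^ (x * logGain) *_) (^^-swap (Ψ x) Q target) ⟩
      2 ^ (x * logGain) * (Ψ x ^ target) ^ Q
        ≤⟨ combine ((x !) ^ (Q * ∑ facMul facʳ)) (facProd x facˡ ^ Q) (facProd x facʳ ^ Q) (stpProd x steps ^ Q) (stpProd x tail ^ Q)
             (2 ^ (x * ∑ facLog facˡ)) (2 ^ (x * logGain)) (2 ^ (u * x * ∑ stpMul steps) * 2 ^ (v * x * ∑ stpMul tail))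
             ((Ψ x ^ target) ^ Q) ((Hits x ^ excess) ^ Q) (N ^ (Q * ∑ facTot facˡ)) (N ^ (Q * (∑ facTot facʳ + ∑ facTot facʳ))) (N ^ stepExp)
             (1≤^ {x !} (Q * ∑ facMul facʳ) (>-nonZero⁻¹ (x !) {{_!≢0 x}}))
             powered
             (subst (λ k → (x !) ^ (Q * k) ≤ facProd x facˡ ^ Q * 2 ^ (x * ∑ facLog facˡ) * N ^ (Q * ∑ facTot facˡ)) balanced (facProd-lower x≤N facˡ logˡ))
             (facProd-upper x≤N facʳ logʳ dens)
             step-bound ⟩
      2 ^ (x * ∑ facLog facˡ) * (2 ^ (u * x * ∑ stpMul steps) * 2 ^ (v * x * ∑ stpMul tail)) * (Hits x ^ excess) ^ Q *
        (N ^ (Q * ∑ facTot facˡ) * N ^ (Q * (∑ facTot facʳ + ∑ facTot facʳ)) * N ^ stepExp)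
        ≡⟨ cong₂ _*_ (cong (_* (Hits x ^ excess) ^ Q) twos) enns ⟩
      2 ^ (x * logLoss) * (Hits x ^ excess) ^ Q * N ^ errorExp ∎
      where
      open ≤-Reasoning
      stepExp = e * ∑ stpTot steps + eᵥ * ∑ stpTot tail
      e₂ : ∀ x a u r k s → x * a + (u * x * r + k * x * s) ≡ x * (a + u * r + k * s)
      e₂ = solve-∀
      powered : facProd x facˡ ^ Q * (Ψ x ^ target) ^ Q ≤
                facProd x facʳ ^ Q * stpProd x steps ^ Q * stpProd x tail ^ Q * (Hits x ^ excess) ^ Q
      powered = subst₂ _≤_
        (^-distribʳ-* (facProd x facˡ) (Ψ x ^ target) Q)
        (trans (^-distribʳ-* _ (Hits x ^ excess) Q) (cong (_* (Hits x ^ excess) ^ Q)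
          (trans (^-distribʳ-* _ (stpProd x tail) Q) (cong (_* stpProd x tail ^ Q) (^-distribʳ-* (facProd x facʳ) _ Q)))))
        (^-monoˡ-≤ Q (summed x≤N))
      step-bound : stpProd x steps ^ Q * stpProd x tail ^ Q ≤ 2 ^ (u * x * ∑ stpMul steps) * 2 ^ (v * x * ∑ stpMul tail) * N ^ stepExp
      step-bound = ≤-trans (*-mono-≤ (stpProd-upper up x≤N steps) (stpProd-upper tail-up x≤N tail))
        (≤-reflexive (trans ([m*n]*[o*p]≡[m*o]*[n*p] (2 ^ (u * x * ∑ stpMul steps)) (N ^ (e * ∑ stpTot steps)) (2 ^ (v * x * ∑ stpMul tail)) (N ^ (eᵥ * ∑ stpTot tail)))
          (cong (2 ^ (u * x * ∑ stpMul steps) * 2 ^ (v * x * ∑ stpMul tail) *_) (sym (^-distribˡ-+-* N (e * ∑ stpTot steps) (eᵥ * ∑ stpTot tail))))))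
      twos : 2 ^ (x * ∑ facLog facˡ) * (2 ^ (u * x * ∑ stpMul steps) * 2 ^ (v * x * ∑ stpMul tail)) ≡ 2 ^ (x * logLoss)
      twos = trans (cong (2 ^ (x * ∑ facLog facˡ) *_) (sym (^-distribˡ-+-* 2 (u * x * ∑ stpMul steps) (v * x * ∑ stpMul tail))))
        (trans (sym (^-distribˡ-+-* 2 (x * ∑ facLog facˡ) _)) (cong (2 ^_) (e₂ x (∑ facLog facˡ) u (∑ stpMul steps) v (∑ stpMul tail))))
      enns = trans (cong (_* N ^ stepExp) (sym (^-distribˡ-+-* N (Q * ∑ facTot facˡ) (Q * (∑ facTot facʳ + ∑ facTot facʳ)))))
        (sym (^-distribˡ-+-* N (Q * ∑ facTot facˡ + Q * (∑ facTot facʳ + ∑ facTot facʳ)) stepExp))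

    -- The old slope enters `logLoss` only through the multipliers of the steps. When these are
    -- small compared with `target`, the new slope can be smaller than the old one, and the argument
    -- can be iterated.
    improve-upper : ∀ {u′ e″} → 1 ≤ target → excess ≡ 0 →
      logLoss ≤ target * u′ + logGain → errorExp ≤ target * e″ → Upper u′ e″
    improve-upper {u′} {e″} 1≤p refl main err = upper λ {x} x≤N → ^-cancelʳ-≤ _ _ target 1≤p
      (*-cancelˡ-≤ (2 ^ (x * logGain)) {{m^n≢0 2 (x * logGain)}} (begin
        2 ^ (x * logGain) * (Ψ x ^ Q) ^ target
          ≤⟨ estimate x≤N ⟩
        2 ^ (x * logLoss) * 1 ^ Q * N ^ errorExp
          ≡⟨ cong (_* N ^ errorExp) (trans (cong (2 ^ (x * logLoss) *_) (^-zeroˡ Q)) (*-identityʳ (2 ^ (x * logLoss)))) ⟩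
        2 ^ (x * logLoss) * N ^ errorExp
          ≤⟨ *-mono-≤ (^-monoʳ-≤ 2 (*-monoʳ-≤ x main)) (^-monoʳ-≤ N {{>-nonZero 1≤N}} err) ⟩
        2 ^ (x * (target * u′ + logGain)) * N ^ (target * e″)
          ≡⟨ cong₂ _*_ (trans (cong (2 ^_) (e₁ x target u′ logGain)) (^-distribˡ-+-* 2 (x * logGain) (u′ * x * target))) (cong (N ^_) (*-comm target e″)) ⟩
        2 ^ (x * logGain) * 2 ^ (u′ * x * target) * N ^ (e″ * target)
          ≡⟨ trans (*-assoc (2 ^ (x * logGain)) _ _) (cong (2 ^ (x * logGain) *_) (trans (cong₂ _*_ (sym (^-*-assoc 2 (u′ * x) target)) (sym (^-*-assoc N e″ target))) (sym (^-distribʳ-* (2 ^ (u′ * x)) (N ^ e″) target)))) ⟩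
        2 ^ (x * logGain) * (2 ^ (u′ * x) * N ^ e″) ^ target ∎))
      where
      open ≤-Reasoning
      e₁ : ∀ x p u g → x * (p * u + g) ≡ x * g + u * x * p
      e₁ = solve-∀

-- Verification of functionals

∧-split : ∀ {x y} → T (x ∧ y) → T x × T y
∧-split = Equivalence.to T-∧

∨-split : ∀ {x y} → T (x ∨ y) → T x ⊎ T y
∨-split = Equivalence.to T-∨

true⇒T : ∀ {b} → b ≡ true → T b
true⇒T refl = tt

below : (ℕ → Bool) → ℕ → Bool
below P zero    = true
below P (suc n) = P n ∧ below P n

below-sound : ∀ P n → T (below P n) → ∀ {i} → i < n → T (P i)
below-sound P (suc n) t {i} i<1+n with i ≟ n
... | yes refl = proj₁ (∧-split t)
... | no i≢n   = below-sound P n (proj₂ (∧-split {P n} t)) (≤∧≢⇒< (≤-pred i<1+n) i≢n)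

every : {A : Set} → (A → Bool) → List A → Bool
every P []       = true
every P (x ∷ xs) = P x ∧ every P xs

every-sound : ∀ {A : Set} {Q : A → Set} {P : A → Bool} → (∀ x → T (P x) → Q x) → ∀ xs → T (every P xs) → All Q xs
every-sound s []       t = []
every-sound {P = P} s (x ∷ xs) t = s x (proj₁ (∧-split t)) ∷ every-sound s xs (proj₂ (∧-split {P x} t))

divisible : ℕ → ℕ → Bool
divisible a D = D ÷ a * a ≡ᵇ D

÷-* : ∀ m n o → m ÷ (n * o) ≡ m ÷ o ÷ n
÷-* m zero    o       = refl
÷-* m (suc n) zero    = trans (cong (m ÷_) (*-zeroʳ n)) (sym (0/n≡0 (suc n)))
÷-* m (suc n) (suc o) = trans (/-congʳ {m = m} (*-comm (suc n) (suc o))) (sym (m/n/o≡m/[n*o] m (suc o) (suc n)))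

∑-cong : ∀ {A : Set} {P : A → Set} {f g : A → ℕ} → (∀ x → P x → f x ≡ g x) → ∀ {xs} → All P xs → ∑ f xs ≡ ∑ g xs
∑-cong f≡g []         = refl
∑-cong f≡g (px ∷ pxs) = cong₂ _+_ (f≡g _ px) (∑-cong f≡g pxs)

-- Correct for all f, and fast when n < 2 ^ f.
pow : ℕ → ℕ → ℕ → ℕ
pow zero    b n = b ^ n
pow (suc f) b n = b ^ (n % 2) * pow f (b * b) (n / 2)

pow≡^ : ∀ f b n → pow f b n ≡ b ^ n
pow≡^ zero    b n = refl
pow≡^ (suc f) b n = begin
  b ^ (n % 2) * pow f (b * b) (n / 2)   ≡⟨ cong (b ^ (n % 2) *_) (pow≡^ f (b * b) (n / 2)) ⟩
  b ^ (n % 2) * (b * b) ^ (n / 2)       ≡⟨ cong (λ k → b ^ (n % 2) * (b * k) ^ (n / 2)) (*-identityʳ b) ⟨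
  b ^ (n % 2) * (b ^ 2) ^ (n / 2)       ≡⟨ cong (b ^ (n % 2) *_) (^-*-assoc b 2 (n / 2)) ⟩
  b ^ (n % 2) * b ^ (2 * (n / 2))       ≡⟨ ^-distribˡ-+-* b (n % 2) (2 * (n / 2)) ⟨
  b ^ (n % 2 + 2 * (n / 2))             ≡⟨ cong (b ^_) (trans (cong (n % 2 +_) (*-comm 2 (n / 2))) (sym (m≡m%n+[m/n]*n n 2))) ⟩
  b ^ n                                 ∎
  where open ≡-Reasoning

upperLogᵇ lowerLogᵇ : ℕ → ℕ → Fac → Bool
upperLogᵇ fuel Q (fac D m a) = (1 ≤ᵇ D) ∧ (pow fuel D Q ≤ᵇ pow fuel 2 a)
lowerLogᵇ fuel Q (fac D m a) = (1 ≤ᵇ D) ∧ (pow fuel 2 a ≤ᵇ pow fuel D Q)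

upperLog-sound : ∀ {fuel Q} x → T (upperLogᵇ fuel Q x) → UpperLog Q x
upperLog-sound {fuel} {Q} (fac D m a) t = ≤ᵇ⇒≤ 1 D (proj₁ (∧-split t)) ,
  subst₂ _≤_ (pow≡^ fuel D Q) (pow≡^ fuel 2 a) (≤ᵇ⇒≤ _ _ (proj₂ (∧-split {1 ≤ᵇ D} t)))

lowerLog-sound : ∀ {fuel Q} x → T (lowerLogᵇ fuel Q x) → LowerLog Q x
lowerLog-sound {fuel} {Q} (fac D m a) t = ≤ᵇ⇒≤ 1 D (proj₁ (∧-split t)) ,
  subst₂ _≤_ (pow≡^ fuel 2 a) (pow≡^ fuel D Q) (≤ᵇ⇒≤ _ _ (proj₂ (∧-split {1 ≤ᵇ D} t)))

-- The products m * D are formed in advance, since the sums are evaluated at thousands of sample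
-- points.
data Terms : Set where
  nil  : Terms
  term : ℕ → ℕ → Terms → Terms

terms : List Fac → Terms
terms []               = nil
terms (fac D m a ∷ xs) = term D (m * D) (terms xs)

quick : ℕ → Terms → ℕ → ℕ
quick W nil           s = s
quick W (term D c ts) s = quick W ts (c * (W ÷ D) + s)

quick≡∑ : ∀ W xs s → quick W (terms xs) s ≡ ∑ (facVal W) xs + s
quick≡∑ W []               s = refl
quick≡∑ W (fac D m a ∷ xs) s = trans (quick≡∑ W xs (m * D * (W ÷ D) + s)) (rearr (∑ (facVal W) xs) (m * D * (W ÷ D)) s)
  where
  rearr : ∀ a b c → a + (b + c) ≡ b + a + c
  rearr = solve-∀

denBoundᵇ : ℕ → Fac → Bool
denBoundᵇ K (fac D m a) = D ≤ᵇ K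

denBound-sound : ∀ {K} x → T (denBoundᵇ K x) → DenBound K x
denBound-sound (fac D m a) t = ≤ᵇ⇒≤ D _ t

denBound-mono : ∀ {K N} → K ≤ N → ∀ {xs} → All (DenBound K) xs → All (DenBound N) xs
denBound-mono K≤N []                    = []
denBound-mono K≤N (_∷_ {fac D m a} p ps) = ≤-trans p K≤N ∷ denBound-mono K≤N ps

∑facVal≤ : ∀ W xs → ∑ (facVal W) xs ≤ ∑ facMul xs * W
∑facVal≤ W []               = z≤n
∑facVal≤ W (fac D m a ∷ xs) = begin
  m * D * (W ÷ D) + ∑ (facVal W) xs     ≡⟨ cong (_+ ∑ (facVal W) xs) (*-assoc m D (W ÷ D)) ⟩
  m * (D * (W ÷ D)) + ∑ (facVal W) xs   ≤⟨ +-mono-≤ (*-monoʳ-≤ m (n*[m÷n]≤m W D)) (∑facVal≤ W xs) ⟩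
  m * W + ∑ facMul xs * W               ≡⟨ *-distribʳ-+ W m (∑ facMul xs) ⟨
  (m + ∑ facMul xs) * W                 ∎
  where open ≤-Reasoning

≤∑facVal : ∀ {Q} W {xs} → All (LowerLog Q) xs → ∑ facMul xs * W ≤ ∑ (facVal W) xs + ∑ facTot xs
≤∑facVal W []                                        = z≤n
≤∑facVal {Q} W (_∷_ {fac D m a} {xs} (1≤D , _) lo) = begin
  (m + ∑ facMul xs) * W                                            ≡⟨ *-distribʳ-+ W m (∑ facMul xs) ⟩
  m * W + ∑ facMul xs * W                                          ≤⟨ +-mono-≤ (*-monoʳ-≤ m (m≤n*[m÷n]+n W D 1≤D)) (≤∑facVal {Q} W lo) ⟩
  m * (D * (W ÷ D) + D) + (∑ (facVal W) xs + ∑ facTot xs)          ≡⟨ rearr m D (W ÷ D) (∑ (facVal W) xs) (∑ facTot xs) ⟩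
  m * D * (W ÷ D) + ∑ (facVal W) xs + (m * D + ∑ facTot xs)        ∎
  where
  open ≤-Reasoning
  rearr : ∀ m D w v c → m * (D * w + D) + (v + c) ≡ m * D * w + v + (m * D + c)
  rearr = solve-∀

module _ (f : Functional) where
  open Functional f

  onGrid : ℕ → Bool
  onGrid D = divisible gridˡ D ∨ divisible gridʳ D

  facOnGrid : Fac → Bool
  facOnGrid (fac D m a) = onGrid D

  stpOnGrid : Step → Bool
  stpOnGrid (stp T r) = onGrid T

  sample : Terms → Terms → ℕ → Bool
  sample l r W = quick W l (target * (1 ⊓ W)) ≤ᵇ quick W r (∑ (stpVal W) steps + ∑ (stpVal W) (tail ∷ []) + excess * hit W)

  sample-sound : ∀ W → T (sample (terms facˡ) (terms facʳ) W) → lhs W ≤ rhs W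
  sample-sound W t = subst₂ _≤_ (quick≡∑ W facˡ _) (trans (quick≡∑ W facʳ _) (rearr (∑ (facVal W) facʳ) _ _ _)) (≤ᵇ⇒≤ _ _ t)
    where
    rearr : ∀ a b c d → a + (b + c + d) ≡ a + b + c + d
    rearr = solve-∀

  samples : Terms → Terms → ℕ → ℕ → Bool
  samples l r c = below (λ i → sample l r (c * i))

  -- All denominators and thresholds being multiples of `gridˡ` or `gridʳ`, both sides change only
  -- at multiples of these two numbers. Beyond the threshold of `tail` nothing needs sampling, so
  -- finitely many points decide the inequality for every W.
  check : ℕ → ℕ → ℕ → Bool
  check fuel Q K =
    (∑ facMul facˡ ≡ᵇ ∑ facMul facʳ) ∧
    every (upperLogᵇ fuel Q) facˡ ∧ every (lowerLogᵇ fuel Q) facʳ ∧ every (denBoundᵇ K) facʳ ∧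
    -- The term target * (1 ⊓ W) already jumps at W = 1, which the sample points see only on the
    -- grid 1.
    (1 ≤ᵇ gridˡ) ∧ (1 ≤ᵇ gridʳ) ∧ ((gridˡ ≡ᵇ 1) ∨ (target ≡ᵇ 0)) ∧
    every facOnGrid facˡ ∧ every facOnGrid facʳ ∧ every stpOnGrid steps ∧ every stpOnGrid (tail ∷ []) ∧
    (1 ≤ᵇ Step.thr tail) ∧ (∑ facTot facʳ + target ≤ᵇ stpTot tail) ∧
    samples (terms facˡ) (terms facʳ) gridˡ (suc (Step.thr tail ÷ gridˡ)) ∧
    samples (terms facˡ) (terms facʳ) gridʳ (suc (Step.thr tail ÷ gridʳ))

  -- Since the multipliers balance, lhs and rhs without tail differ by a bounded amount.
  beyond-tail : ∀ {Q W} → ∑ facMul facˡ ≡ ∑ facMul facʳ → All (LowerLog Q) facʳ → 1 ≤ Step.thr tail →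
    ∑ facTot facʳ + target ≤ stpTot tail → Step.thr tail ≤ W → lhs W ≤ rhs W
  beyond-tail {Q} {W} bal lo 1≤T big T≤W = begin
    ∑ (facVal W) facˡ + target * (1 ⊓ W)
      ≤⟨ +-mono-≤ (∑facVal≤ W facˡ) (≤-trans (*-monoʳ-≤ target (m⊓n≤m 1 W)) (≤-reflexive (*-identityʳ target))) ⟩
    ∑ facMul facˡ * W + target
      ≤⟨ +-monoˡ-≤ target (subst (λ k → k * W ≤ ∑ (facVal W) facʳ + ∑ facTot facʳ) (sym bal) (≤∑facVal {Q} W lo)) ⟩
    ∑ (facVal W) facʳ + ∑ facTot facʳ + target
      ≡⟨ +-assoc (∑ (facVal W) facʳ) _ _ ⟩
    ∑ (facVal W) facʳ + (∑ facTot facʳ + target)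
      ≤⟨ +-mono-≤ (m≤m+n (∑ (facVal W) facʳ) (∑ (stpVal W) steps)) (≤-trans big (≤-reflexive active)) ⟩
    ∑ (facVal W) facʳ + ∑ (stpVal W) steps + ∑ (stpVal W) (tail ∷ [])
      ≤⟨ m≤m+n _ (excess * hit W) ⟩
    rhs W ∎
    where
    open ≤-Reasoning
    active : stpTot tail ≡ stpVal W tail + 0
    active = sym (trans (+-identityʳ _) (trans (cong (λ k → Step.mul tail * Step.thr tail * k)
      (m≤n⇒m⊓n≡m (÷≥1 1≤T T≤W))) (*-identityʳ _)))

  module _ {W W′} (l : W ÷ gridˡ ≡ W′ ÷ gridˡ) (r : W ÷ gridʳ ≡ W′ ÷ gridʳ) where

    ÷-grid : ∀ D → T (onGrid D) → W ÷ D ≡ W′ ÷ D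
    ÷-grid D t with ∨-split t
    ... | inj₁ t = via gridˡ l (≡ᵇ⇒≡ _ D t)
      where
      via : ∀ g → W ÷ g ≡ W′ ÷ g → D ÷ g * g ≡ D → W ÷ D ≡ W′ ÷ D
      via g e d = subst (λ k → W ÷ k ≡ W′ ÷ k) d (trans (÷-* W (D ÷ g) g) (trans (cong (_÷ (D ÷ g)) e) (sym (÷-* W′ (D ÷ g) g))))
    ... | inj₂ t = via gridʳ r (≡ᵇ⇒≡ _ D t)
      where
      via : ∀ g → W ÷ g ≡ W′ ÷ g → D ÷ g * g ≡ D → W ÷ D ≡ W′ ÷ D
      via g e d = subst (λ k → W ÷ k ≡ W′ ÷ k) d (trans (÷-* W (D ÷ g) g) (trans (cong (_÷ (D ÷ g)) e) (sym (÷-* W′ (D ÷ g) g))))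

    facs : ∀ xs → T (every facOnGrid xs) → ∑ (facVal W) xs ≡ ∑ (facVal W′) xs
    facs xs t = ∑-cong {P = λ x → T (facOnGrid x)} (λ { (fac D m a) t → cong (m * D *_) (÷-grid D t) }) (every-sound (λ _ t → t) xs t)

    stps : ∀ xs → T (every stpOnGrid xs) → ∑ (stpVal W) xs ≡ ∑ (stpVal W′) xs
    stps xs t = ∑-cong {P = λ x → T (stpOnGrid x)} (λ { (stp D r) t → cong (λ k → r * D * (1 ⊓ k)) (÷-grid D t) }) (every-sound (λ _ t → t) xs t)

  -- The largest multiple of gridˡ or gridʳ below W has the same quotients by gridˡ and gridʳ as W.
  round : ℕ → ℕ
  round W = (gridˡ * (W ÷ gridˡ)) ⊔ (gridʳ * (W ÷ gridʳ))

  round≤ : ∀ W → round W ≤ W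
  round≤ W = ⊔-lub (n*[m÷n]≤m W gridˡ) (n*[m÷n]≤m W gridʳ)

  round-÷ˡ : ∀ W → 1 ≤ gridˡ → W ÷ gridˡ ≡ round W ÷ gridˡ
  round-÷ˡ W 1≤g = ≤-antisym (≤-trans (≤-reflexive (sym (n*k÷n gridˡ (W ÷ gridˡ) 1≤g))) (÷-monoˡ-≤ gridˡ (m≤m⊔n _ _))) (÷-monoˡ-≤ gridˡ (round≤ W))

  round-÷ʳ : ∀ W → 1 ≤ gridʳ → W ÷ gridʳ ≡ round W ÷ gridʳ
  round-÷ʳ W 1≤g = ≤-antisym (≤-trans (≤-reflexive (sym (n*k÷n gridʳ (W ÷ gridʳ) 1≤g))) (÷-monoˡ-≤ gridʳ (m≤n⊔m (gridˡ * (W ÷ gridˡ)) _))) (÷-monoˡ-≤ gridʳ (round≤ W))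

  check-sound : ∀ fuel Q K → check fuel Q K ≡ true → Valid Q f × All (DenBound K) facʳ
  check-sound fuel Q K checked with ∧-split (true⇒T checked)
  ... | bal , t₁ with ∧-split t₁
  ... | up , t₂ with ∧-split t₂
  ... | lo , t₃ with ∧-split t₃
  ... | den , t₄ with ∧-split t₄
  ... | gl , t₅ with ∧-split t₅
  ... | gr , t₆ with ∧-split t₆
  ... | unit , t₇ with ∧-split t₇
  ... | fl , t₈ with ∧-split t₈
  ... | fr , t₉ with ∧-split t₉
  ... | st , t₁₀ with ∧-split t₁₀
  ... | tl , t₁₁ with ∧-split t₁₁
  ... | thr , t₁₂ with ∧-split t₁₂
  ... | big , t₁₃ with ∧-split t₁₃
  ... | samˡ , samʳ = record
        { balanced = balanced
        ; logˡ     = every-sound (upperLog-sound {fuel} {Q}) facˡ up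
        ; logʳ     = logʳ
        ; lhs≤rhs  = case
        } , every-sound (denBound-sound {K}) facʳ den
    where
    balanced = ≡ᵇ⇒≡ _ _ bal
    logʳ     = every-sound (lowerLog-sound {fuel} {Q}) facʳ lo
    1≤gˡ     = ≤ᵇ⇒≤ 1 gridˡ gl
    1≤gʳ     = ≤ᵇ⇒≤ 1 gridʳ gr
    eˡ : ∀ W → W ÷ gridˡ ≡ round W ÷ gridˡ
    eˡ W = round-÷ˡ W 1≤gˡ
    eʳ : ∀ W → W ÷ gridʳ ≡ round W ÷ gridʳ
    eʳ W = round-÷ʳ W 1≤gʳ
    target-round : ∀ W → target * (1 ⊓ W) ≡ target * (1 ⊓ round W)
    target-round W with ∨-split {gridˡ ≡ᵇ 1} unit
    ... | inj₁ g = cong (λ k → target * (1 ⊓ k))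
          (trans (sym (n/1≡n W)) (trans (subst (λ g → W ÷ g ≡ round W ÷ g) (≡ᵇ⇒≡ gridˡ 1 g) (eˡ W)) (n/1≡n (round W))))
    ... | inj₂ z = trans (cong (_* (1 ⊓ W)) (≡ᵇ⇒≡ target 0 z)) (sym (cong (_* (1 ⊓ round W)) (≡ᵇ⇒≡ target 0 z)))
    lhs-round : ∀ W → lhs W ≡ lhs (round W)
    lhs-round W = cong₂ _+_ (facs {W} {round W} (eˡ W) (eʳ W) facˡ fl) (target-round W)
    rhs-round : ∀ W → rhs W ≡ rhs (round W)
    rhs-round W = cong₂ _+_
      (cong₂ _+_ (cong₂ _+_ (facs {W} {round W} (eˡ W) (eʳ W) facʳ fr) (stps {W} {round W} (eˡ W) (eʳ W) steps st)) (stps {W} {round W} (eˡ W) (eʳ W) (tail ∷ []) tl))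
      (cong (excess *_) (cong₂ (λ a b → 1 ⊓ a ∸ b) (eˡ W) (eʳ W)))
    sampled : ∀ c W → T (samples (terms facˡ) (terms facʳ) c (suc (Step.thr tail ÷ c))) → W < Step.thr tail → round W ≡ c * (W ÷ c) → lhs W ≤ rhs W
    sampled c W sam W<T e = subst₂ _≤_ (sym (lhs-round W)) (sym (rhs-round W)) (subst (λ k → lhs k ≤ rhs k) (sym e)
      (sample-sound _ (below-sound (λ i → sample (terms facˡ) (terms facʳ) (c * i)) _ sam (s≤s (÷-monoˡ-≤ c (<⇒≤ W<T))))))
    case : ∀ W → lhs W ≤ rhs W
    case W with Step.thr tail ≤? W
    ... | yes T≤W = beyond-tail {Q} balanced logʳ (≤ᵇ⇒≤ 1 _ thr) (≤ᵇ⇒≤ _ _ big) T≤W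
    ... | no  T≰W with ⊔-sel (gridˡ * (W ÷ gridˡ)) (gridʳ * (W ÷ gridʳ))
    ...   | inj₁ e = sampled gridˡ W samˡ (≰⇒> T≰W) e
    ...   | inj₂ e = sampled gridʳ W samʳ (≰⇒> T≰W) e

-- Existence of primes

∏≤ : ∀ n R B (f : ℕ → ℕ) → 1 ≤ B → (∀ i → 1 ≤ i → f i ≤ B) → (∀ i → R < i → f i ≤ 1) → ∏ n f ≤ B ^ (n ⊓ R)
∏≤ zero    R B f 1≤B f≤B f≤1 = ≤-refl
∏≤ (suc n) R B f 1≤B f≤B f≤1 with suc n ≤? R
... | yes 1+n≤R = begin
  ∏ n f * f (suc n)       ≤⟨ *-mono-≤ (∏≤ n R B f 1≤B f≤B f≤1) (f≤B (suc n) z<s) ⟩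
  B ^ (n ⊓ R) * B         ≡⟨ *-comm (B ^ (n ⊓ R)) B ⟩
  B ^ suc (n ⊓ R)         ≡⟨ cong (λ k → B ^ suc k) (m≤n⇒m⊓n≡m (<⇒≤ 1+n≤R)) ⟩
  B ^ suc n               ≡⟨ cong (B ^_) (m≤n⇒m⊓n≡m 1+n≤R) ⟨
  B ^ (suc n ⊓ R)         ∎
  where open ≤-Reasoning
... | no 1+n≰R = begin
  ∏ n f * f (suc n)       ≤⟨ *-mono-≤ (∏≤ n R B f 1≤B f≤B f≤1) (f≤1 (suc n) (≰⇒> 1+n≰R)) ⟩
  B ^ (n ⊓ R) * 1         ≡⟨ *-identityʳ _ ⟩
  B ^ (n ⊓ R)             ≤⟨ ^-monoʳ-≤ B {{>-nonZero 1≤B}} (⊓-monoˡ-≤ R (n≤1+n n)) ⟩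
  B ^ (suc n ⊓ R)         ∎
  where open ≤-Reasoning

module _ (N Q : ℕ) (2≤N : 2 ≤ N) where
  open Weights N
  open Estimates N Q 2≤N

  -- The factor is p as long as p ^ j ≤ N and 1 afterwards, so the product is itself a power of p
  -- not exceeding N.
  ∏-powers≤N : ∀ p J → 1 ≤ p → (∏ J λ j → p ^ (1 ⊓ (N ÷ p ^ j))) ≤ N
  ∏-powers≤N p zero    1≤p = 1≤N
  ∏-powers≤N p (suc J) 1≤p with p ^ suc J ≤? N
  ... | yes p^≤N = ≤-trans (all-p (suc J)) p^≤N
    where
    instance
      _ : NonZero p
      _ = >-nonZero 1≤p
    all-p : ∀ J → (∏ J λ j → p ^ (1 ⊓ (N ÷ p ^ j))) ≤ p ^ J
    all-p zero    = ≤-refl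
    all-p (suc J) = ≤-trans (*-mono-≤ (all-p J) (^-monoʳ-≤ p (m⊓n≤m 1 (N ÷ p ^ suc J)))) (≤-reflexive (trans (cong (p ^ J *_) (*-identityʳ p)) (*-comm (p ^ J) p)))
  ... | no p^≰N = ≤-trans (≤-reflexive (trans (cong (λ k → (∏ J λ j → p ^ (1 ⊓ (N ÷ p ^ j))) * p ^ (1 ⊓ k)) (÷≡0 (≰⇒> p^≰N))) (*-identityʳ _)))
    (∏-powers≤N p J 1≤p)

  -- Only proper prime powers contribute, hence only primes up to √N.
  hits≤ : ∀ (h : ℕ → ℕ) R → (∀ W → h W ≤ 1 ⊓ W) → (∀ p → Prime p → h (N ÷ p) ≡ 0) →
    (∀ p → R < p → N < p * p) → ⟦ (λ q → h (N ÷ q)) ⟧ ≤ N ^ R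
  hits≤ h R h≤ no-primes R<p = ≤-trans (∏≤ N R N inner 1≤N small large) (^-monoʳ-≤ N {{>-nonZero 1≤N}} (m⊓n≤n N R))
    where
    inner : ℕ → ℕ
    inner p = ∏ N λ j → base p ^ h (N ÷ p ^ j)
    h0 : ∀ {W} → W ≡ 0 → h W ≡ 0
    h0 refl = n≤0⇒n≡0 (h≤ 0)
    small : ∀ p → 1 ≤ p → inner p ≤ N
    small p 1≤p = ≤-trans (∏-mono-≤ N λ j _ _ → ≤-trans (^-monoʳ-≤ (base p) {{>-nonZero (base≥1 p)}} (h≤ (N ÷ p ^ j)))
      (^-monoˡ-≤ (1 ⊓ (N ÷ p ^ j)) (base≤ p 1≤p))) (∏-powers≤N p N 1≤p)
    large : ∀ p → R < p → inner p ≤ 1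
    large p R<p′ = ≤-reflexive (∏-ones N λ j 1≤j _ → factor j 1≤j)
      where
      factor : ∀ j → 1 ≤ j → base p ^ h (N ÷ p ^ j) ≡ 1
      factor (suc zero) _ with prime? p
      ... | no _   = ^-zeroˡ (h (N ÷ (p * 1)))
      ... | yes pp = cong (p ^_) (trans (cong (λ k → h (N ÷ k)) (*-identityʳ p)) (no-primes p pp))
      factor (suc (suc j)) _ = cong (base p ^_) (h0 (÷≡0 (≤-trans (R<p p R<p′) (*-monoʳ-≤ p (m≤m*n p (p ^ j) {{m^n≢0 p j {{>-nonZero (≤-<-trans z≤n R<p′)}}}})))))

-- Replaces √N and log N: √N < 2 ^ suc j, and the binary logarithm of N is below 2 * suc j.
4^-between : ∀ k N → 4 ^ k ≤ N → ∃ λ j → k ≤ j × 4 ^ j ≤ N × N < 4 ^ suc j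
4^-between k N 4^k≤N = go N (n<m^n 4 N (s≤s (s≤s z≤n)))
  where
  go : ∀ m → N < 4 ^ m → ∃ λ j → k ≤ j × 4 ^ j ≤ N × N < 4 ^ suc j
  go zero    N<1 = contradiction (≤-trans (1≤^ {4} k (s≤s z≤n)) 4^k≤N) (<⇒≱ N<1)
  go (suc m) N<  with 4 ^ m ≤? N
  ... | no ≰N = go m (≰⇒> ≰N)
  ... | yes 4^m≤N = m , ≮⇒≥ (λ m<k → <⇒≱ N< (≤-trans (^-monoʳ-≤ 4 m<k) 4^k≤N)) , 4^m≤N , N<

-- Raising k by one multiplies the right side by 4 and the left side by at most 4, since suc (suc k)
-- ≤ 2 * suc k and the bracket at most doubles.
growth : ∀ B E δ k₀ k → 2 * suc k₀ * (2 ^ suc k₀ * B + E) < 4 ^ k₀ * δ → k₀ ≤ k →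
  2 * suc k * (2 ^ suc k * B + E) < 4 ^ k * δ
growth B E δ k₀ k base k₀≤k = subst (λ k → 2 * suc k * (2 ^ suc k * B + E) < 4 ^ k * δ) (m+[n∸m]≡n k₀≤k) (go (k ∸ k₀))
  where
  go : ∀ i → 2 * suc (k₀ + i) * (2 ^ suc (k₀ + i) * B + E) < 4 ^ (k₀ + i) * δ
  go zero    = subst (λ k → 2 * suc k * (2 ^ suc k * B + E) < 4 ^ k * δ) (sym (+-identityʳ k₀)) base
  go (suc i) = subst (λ k → 2 * suc k * (2 ^ suc k * B + E) < 4 ^ k * δ) (sym (+-suc k₀ i)) (begin-strict
    2 * suc (suc j) * (2 * 2 ^ suc j * B + E)
      ≤⟨ *-mono-≤ (*-monoʳ-≤ 2 (≤-trans (m≤m+n (suc (suc j)) j) (≤-reflexive (e₀ j)))) (≤-trans (+-monoʳ-≤ (2 * 2 ^ suc j * B) (m≤m+n E E)) (≤-reflexive (e₁ (2 ^ suc j) B E))) ⟩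
    2 * (2 * suc j) * (2 * (2 ^ suc j * B + E))
      ≡⟨ e₂ (suc j) (2 ^ suc j * B + E) ⟩
    4 * (2 * suc j * (2 ^ suc j * B + E))
      <⟨ *-monoʳ-< 4 (go i) ⟩
    4 * (4 ^ j * δ)
      ≡⟨ *-assoc 4 (4 ^ j) δ ⟨
    4 ^ suc j * δ ∎)
    where
    open ≤-Reasoning
    j = k₀ + i
    e₀ : ∀ j → suc (suc j) + j ≡ 2 * suc j
    e₀ = solve-∀
    e₁ : ∀ a B E → 2 * a * B + (E + E) ≡ 2 * (a * B + E)
    e₁ = solve-∀
    e₂ : ∀ a b → 2 * (2 * a) * (2 * b) ≡ 4 * (2 * a * b)
    e₂ = solve-∀

module _ (N Q : ℕ) (2≤N : 2 ≤ N) where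
  open Weights N
  open Estimates N Q 2≤N

  module _ (f : Functional) (valid : Valid Q f) (dens : All (DenBound N) (Functional.facʳ f))
           {u e v eᵥ : ℕ} (up : Upper u e) (tail-up : Upper v eᵥ) where
    open Functional f

    -- Without a prime among the hits, `hits≤` bounds them by N ^ R with R > √N. Then `estimate` at
    -- x = N forces 2 ^ (N * δ) ≤ N ^ (R * excess * Q + E), where `E` is `errorExp`, and this
    -- contradicts `growth`.
    prime-hit : ∀ δ k → target ≡ 0 → 1 ≤ gridˡ →
      logLoss f valid dens up tail-up + δ ≤ logGain f valid dens up tail-up →
      2 * suc k * (2 ^ suc k * (excess * Q) + errorExp f valid dens up tail-up) < 4 ^ k * δ →
      4 ^ k ≤ N → ¬ (∀ p → Prime p → hit (N ÷ p) ≡ 0)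
    prime-hit δ k₀ refl 1≤g gain big 4^k≤N no-primes with 4^-between k₀ N 4^k≤N
    ... | k , k₀≤k , lo , hi = <⇒≱ (growth (excess * Q) E δ k₀ k big k₀≤k)
          (≮⇒≥ λ lt → <⇒≱ (^-monoʳ-< 2 ≤-refl lt) (begin
            2 ^ (4 ^ k * δ)
              ≤⟨ ^-monoʳ-≤ 2 (*-monoˡ-≤ δ lo) ⟩
            2 ^ (N * δ)
              ≤⟨ *-cancelˡ-≤ (2 ^ (N * L)) {{m^n≢0 2 (N * L)}} bound ⟩
            N ^ (R * excess * Q) * N ^ E
              ≡⟨ ^-distribˡ-+-* N (R * excess * Q) E ⟨
            N ^ (R * excess * Q + E)
              ≤⟨ ^-monoˡ-≤ (R * excess * Q + E) (<⇒≤ hi) ⟩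
            (4 ^ suc k) ^ (R * excess * Q + E)
              ≡⟨ trans (cong (_^ (R * excess * Q + E)) (^-*-assoc 2 2 (suc k))) (trans (^-*-assoc 2 (2 * suc k) (R * excess * Q + E)) (cong (λ j → 2 ^ (2 * suc k * (j + E))) (*-assoc R excess Q))) ⟩
            2 ^ (2 * suc k * (R * (excess * Q) + E)) ∎))
      where
      open ≤-Reasoning
      L = logLoss f valid dens up tail-up
      G = logGain f valid dens up tail-up
      E = errorExp f valid dens up tail-up
      R = 2 ^ suc k
      hit≤ : ∀ W → hit W ≤ 1 ⊓ W
      hit≤ W = ≤-trans (m∸n≤m (1 ⊓ (W ÷ gridˡ)) (W ÷ gridʳ)) (⊓-monoʳ-≤ 1 (m÷n≤m W gridˡ))
      R<p : ∀ p → R < p → N < p * p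
      R<p p R<p = <-≤-trans hi (≤-trans (≤-reflexive (trans (^-*-assoc 2 2 (suc k)) (trans (cong (2 ^_) (trans (*-comm 2 (suc k)) (e₁ k))) (^-distribˡ-+-* 2 (suc k) (suc k))))) (*-mono-≤ (<⇒≤ R<p) (<⇒≤ R<p)))
        where
        e₁ : ∀ k → suc k * 2 ≡ suc k + suc k
        e₁ = solve-∀
      hits = hits≤ N Q 2≤N hit R hit≤ no-primes R<p
      bound : 2 ^ (N * L) * 2 ^ (N * δ) ≤ 2 ^ (N * L) * (N ^ (R * excess * Q) * N ^ E)
      bound = begin
        2 ^ (N * L) * 2 ^ (N * δ)     ≡⟨ trans (cong (2 ^_) (*-distribˡ-+ N L δ)) (^-distribˡ-+-* 2 (N * L) (N * δ)) ⟨
        2 ^ (N * (L + δ))             ≤⟨ ^-monoʳ-≤ 2 (*-monoʳ-≤ N gain) ⟩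
        2 ^ (N * G)                   ≡⟨ *-identityʳ _ ⟨
        2 ^ (N * G) * 1               ≤⟨ estimate f valid dens up tail-up ≤-refl ⟩
        2 ^ (N * L) * (Hits f valid dens up tail-up N ^ excess) ^ Q * N ^ E
          ≤⟨ *-monoˡ-≤ (N ^ E) (*-monoʳ-≤ (2 ^ (N * L)) (^-monoˡ-≤ Q (^-monoˡ-≤ excess hits))) ⟩
        2 ^ (N * L) * ((N ^ R) ^ excess) ^ Q * N ^ E
          ≡⟨ trans (*-assoc (2 ^ (N * L)) _ _) (cong (λ j → 2 ^ (N * L) * (j * N ^ E)) (trans (cong (_^ Q) (^-*-assoc N R excess)) (^-*-assoc N (R * excess) Q))) ⟩
        2 ^ (N * L) * (N ^ (R * excess * Q) * N ^ E) ∎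

-- The three functionals

-- The coefficients of the three functionals were found by linear programming.
chebyshev₁ : Functional
chebyshev₁ = functional 1 5000
  (fac 2 50000 10000 ∷ fac 3 33333 15850 ∷ fac 5 6250 23220 ∷ fac 8 6250 30000 ∷ fac 9 2083 31700 ∷
   fac 11 6250 34595 ∷ fac 12 1042 35850 ∷ [])
  (fac 1 100000 0 ∷ fac 6 5208 25849 ∷ [])
  (stp 720 44 ∷ stp 12 5730 ∷ [])
  (stp 5000 47) 100000 0

chebyshev₂ : Functional
chebyshev₂ = functional 1 10000
  (fac 2 50000 10000 ∷ fac 3 33333 15850 ∷ fac 5 20000 23220 ∷ fac 7 14286 28074 ∷ fac 11 7205 34595 ∷
   fac 12 1729 35850 ∷ fac 13 3192 37005 ∷ fac 17 3539 40875 ∷ fac 18 1037 41700 ∷ fac 19 1070 42480 ∷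
   fac 20 1992 43220 ∷ fac 23 3482 45236 ∷ fac 29 2075 48580 ∷ fac 30 2669 49069 ∷ [])
  (fac 1 99999 0 ∷ fac 6 16667 25849 ∷ fac 10 10000 33219 ∷ fac 14 2964 38073 ∷ fac 15 6667 39068 ∷
   fac 21 2826 43923 ∷ fac 22 2678 44594 ∷ fac 24 35 45849 ∷ fac 25 1660 46438 ∷ fac 27 676 47548 ∷
   fac 28 1437 48073 ∷ [])
  (stp 1 15 ∷ stp 35 2277 ∷ stp 36 1095 ∷ stp 40 63 ∷ stp 1500 55 ∷ [])
  (stp 10000 77) 100000 0

sieve : Functional
sieve = functional 14 15
  (fac 14 7144 38074 ∷ fac 30 3333 49069 ∷ fac 45 2222 54919 ∷ fac 75 1333 62289 ∷ fac 84 1190 63924 ∷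
   fac 105 952 67143 ∷ fac 140 714 71293 ∷ fac 165 490 73664 ∷ fac 168 114 73924 ∷ fac 195 353 76074 ∷
   fac 196 669 76148 ∷ fac 224 19 78074 ∷ fac 255 179 79944 ∷ fac 285 351 81549 ∷ fac 294 22 81997 ∷
   fac 308 314 82668 ∷ fac 345 142 84305 ∷ fac 360 205 84919 ∷ fac 364 213 85078 ∷ fac 435 230 87649 ∷
   fac 450 217 88138 ∷ fac 462 97 88518 ∷ fac 465 34 88611 ∷ fac 476 168 88949 ∷ fac 490 40 89367 ∷
   fac 518 35 90169 ∷ fac 532 86 90553 ∷ fac 540 42 90769 ∷ fac 546 122 90928 ∷ fac 600 2 92289 ∷
   fac 615 26 92645 ∷ fac 616 101 92668 ∷ fac 630 154 92993 ∷ fac 645 41 93332 ∷ [])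
  (fac 15 6667 39068 ∷ fac 28 3571 48073 ∷ fac 42 2381 53923 ∷ fac 70 1429 61292 ∷ fac 90 1111 64918 ∷
   fac 98 1020 66147 ∷ fac 150 667 72288 ∷ fac 154 649 72667 ∷ fac 180 125 74918 ∷ fac 182 425 75077 ∷
   fac 210 32 77142 ∷ fac 225 434 78137 ∷ fac 238 354 78948 ∷ fac 266 172 80552 ∷ fac 300 38 82288 ∷
   fac 315 277 82992 ∷ fac 322 14 83309 ∷ fac 330 245 83663 ∷ fac 336 57 83923 ∷ fac 378 33 85622 ∷
   fac 390 145 86073 ∷ fac 392 79 86147 ∷ fac 405 31 86617 ∷ fac 406 144 86653 ∷ fac 420 222 87142 ∷
   fac 434 230 87615 ∷ fac 448 10 88073 ∷ fac 480 108 89068 ∷ fac 504 69 89772 ∷ fac 510 13 89943 ∷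
   fac 525 89 90361 ∷ fac 555 4 91163 ∷ fac 560 21 91292 ∷ fac 570 99 91548 ∷ fac 574 90 91649 ∷
   fac 585 21 91922 ∷ fac 588 108 91996 ∷ fac 602 87 92336 ∷ fac 660 57 93663 ∷ fac 675 26 93987 ∷ [])
  (stp 14 6 ∷ stp 238 67 ∷ stp 406 72 ∷ stp 585 41 ∷ stp 602 20 ∷ stp 855 112 ∷ stp 900 41 ∷
   stp 25200 7 ∷ stp 50400 1 ∷ [])
  (stp 210000 11) 0 100000

chebyshev₁-valid : Valid 10000 chebyshev₁ × All (DenBound 675) (Functional.facʳ chebyshev₁)
chebyshev₁-valid = check-sound chebyshev₁ 20 10000 675 refl

chebyshev₂-valid : Valid 10000 chebyshev₂ × All (DenBound 675) (Functional.facʳ chebyshev₂)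
chebyshev₂-valid = check-sound chebyshev₂ 20 10000 675 refl

sieve-valid : Valid 10000 sieve × All (DenBound 675) (Functional.facʳ sieve)
sieve-valid = check-sound sieve 20 10000 675 refl

sieve-hits-prime : ∀ N → 4 ^ 18 ≤ N → ¬ (∀ p → Prime p → Functional.hit sieve (N ÷ p) ≡ 0)
-- The gain exceeds the loss by at least 394459, and 18 is the least exponent for which `prime-hit`
-- applies with this surplus.
sieve-hits-prime N 4^18≤N = prime-hit N 10000 2≤N sieve (proj₁ sieve-valid) (denBound-mono 675≤N (proj₂ sieve-valid)) upper₂ upper₂ 394459 18 refl (s≤s z≤n)
    (≤ᵇ⇒≤ _ _ tt) (≤ᵇ⇒≤ _ _ tt) 4^18≤N
  where
  675≤N : 675 ≤ N
  675≤N = ≤-trans (≤ᵇ⇒≤ 675 (4 ^ 18) tt) 4^18≤N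
  2≤N : 2 ≤ N
  2≤N = ≤-trans (≤ᵇ⇒≤ 2 675 tt) 675≤N
  open Estimates N 10000 2≤N
  -- The slope 1.7788 log 2 is about 1.233.
  upper₁ : Upper 17788 64375
  upper₁ = improve-upper chebyshev₁ (proj₁ chebyshev₁-valid) (denBound-mono 675≤N (proj₂ chebyshev₁-valid)) crude-upper crude-upper (s≤s z≤n) refl
    (≤ᵇ⇒≤ _ _ tt) (≤ᵇ⇒≤ _ _ tt)
  -- The slope 1.5359 log 2 is about 1.0646. The multipliers of the steps and the tail of `sieve`
  -- add up to 378, so the slope of `upper₁` would raise the loss by 378 * 2429 = 918162, more than
  -- the surplus 394459 used above.
  upper₂ : Upper 15359 849311
  upper₂ = improve-upper chebyshev₂ (proj₁ chebyshev₂-valid) (denBound-mono 675≤N (proj₂ chebyshev₂-valid)) upper₁ upper₁ (s≤s z≤n) refl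
    (≤ᵇ⇒≤ _ _ tt) (≤ᵇ⇒≤ _ _ tt)

-- Primes between y and 15y/14

-- Trial division of n by e + 1, e + 2, …; mod-helper 0 e n e is n % suc e.
trial : ℕ → ℕ → ℕ → Bool
trial zero    e n = false
trial (suc f) e n = (n <ᵇ suc e * suc e) ∨ (not (mod-helper 0 e n e ≡ᵇ 0) ∧ trial f (suc e) n)

trial-sound : ∀ f e n → 2 ≤ n → suc e Rough n → T (trial f e n) → Prime n
trial-sound (suc f) e n 2≤n rough t with ∨-split {n <ᵇ suc e * suc e} t
... | inj₁ n<  = rough∧square>⇒prime {{n>1⇒nonTrivial 2≤n}} rough (<ᵇ⇒< n _ n<)
... | inj₂ t′  = trial-sound f (suc e) n 2≤n (∤⇒rough-suc e∤n rough) (proj₂ (∧-split {not (n % suc e ≡ᵇ 0)} t′))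
  where
  e∤n : suc e ∤ n
  e∤n e∣n = subst (λ b → T (not b)) (Equivalence.to T-≡ (≡⇒≡ᵇ _ 0 (n∣m⇒m%n≡0 n (suc e) e∣n))) (proj₁ (∧-split {not (n % suc e ≡ᵇ 0)} t′))

isPrime : ℕ → ℕ → Bool
isPrime f n = (2 ≤ᵇ n) ∧ trial f 1 n

isPrime-sound : ∀ f n → T (isPrime f n) → Prime n
isPrime-sound f n t with ∧-split {2 ≤ᵇ n} t
... | 2≤n , t′ = trial-sound f 1 n (≤ᵇ⇒≤ 2 n 2≤n) 2-rough t′

climbs : ℕ → ℕ → ℕ → List ℕ → Bool
climbs f top p []       = top ≤ᵇ p
climbs f top p (q ∷ qs) = (14 * q <ᵇ 15 * p) ∧ isPrime f q ∧ climbs f top q qs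

NextPrime : ℕ → Set
NextPrime y = ∃ λ p → Prime p × y < p × 14 * p < 15 * y

climbs-sound : ∀ f top p qs → T (climbs f top p qs) → ∀ y → p ≤ y → y < top → NextPrime y
climbs-sound f top p []       t y p≤y y<top = contradiction (≤-trans (≤ᵇ⇒≤ top p t) p≤y) (<⇒≱ y<top)
climbs-sound f top p (q ∷ qs) t y p≤y y<top with ∧-split {14 * q <ᵇ 15 * p} t
... | near , t′ with ∧-split {isPrime f q} t′ | q ≤? y
...   | _  , t″ | yes q≤y = climbs-sound f top q qs t″ y q≤y y<top
...   | pq , _  | no q≰y  = q , isPrime-sound f q pq , ≰⇒> q≰y , <-≤-trans (<ᵇ⇒< (14 * q) (15 * p) near) (*-monoʳ-≤ 15 p≤y)

ladder-sound : ∀ f top p qs → climbs f top p qs ≡ true → ∀ y → p ≤ y → y < top → NextPrime y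
ladder-sound f top p qs eq = climbs-sound f top p qs (true⇒T eq)

-- Each prime is less than 15/14 times its predecessor, starting from 149.
ladder : List ℕ
ladder =
  157 ∷ 167 ∷ 173 ∷ 181 ∷ 193 ∷ 199 ∷ 211 ∷ 223 ∷ 233 ∷ 241 ∷ 257 ∷ 271 ∷ 283 ∷ 293 ∷ 313 ∷ 331 ∷
  353 ∷ 373 ∷ 397 ∷ 421 ∷ 449 ∷ 479 ∷ 509 ∷ 541 ∷ 577 ∷ 617 ∷ 661 ∷ 701 ∷ 751 ∷ 797 ∷ 853 ∷ 911 ∷
  971 ∷ 1039 ∷ 1109 ∷ 1187 ∷ 1259 ∷ 1327 ∷ 1409 ∷ 1499 ∷ 1601 ∷ 1709 ∷ 1831 ∷ 1951 ∷ 2089 ∷ 2237 ∷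
  2393 ∷ 2557 ∷ 2731 ∷ 2917 ∷ 3121 ∷ 3343 ∷ 3581 ∷ 3833 ∷ 4099 ∷ 4391 ∷ 4703 ∷ 5023 ∷ 5381 ∷ 5749 ∷
  6151 ∷ 6581 ∷ 7043 ∷ 7541 ∷ 8069 ∷ 8641 ∷ 9257 ∷ 9907 ∷ 10613 ∷ 11369 ∷ 12163 ∷ 13009 ∷ 13933 ∷
  14923 ∷ 15973 ∷ 17107 ∷ 18313 ∷ 19609 ∷ 21001 ∷ 22501 ∷ 24107 ∷ 25819 ∷ 27653 ∷ 29611 ∷ 31723 ∷
  33967 ∷ 36389 ∷ 38977 ∷ 41761 ∷ 44741 ∷ 47933 ∷ 51349 ∷ 55009 ∷ 58937 ∷ 63131 ∷ 67631 ∷ 72461 ∷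
  77621 ∷ 83137 ∷ 89071 ∷ 95429 ∷ 102241 ∷ 109541 ∷ 117361 ∷ 125743 ∷ 134707 ∷ 144323 ∷ 154621 ∷
  165653 ∷ 177481 ∷ 190147 ∷ 203713 ∷ 218249 ∷ 233837 ∷ 250501 ∷ 268343 ∷ 287503 ∷ 308027 ∷
  330019 ∷ 353567 ∷ 378821 ∷ 405871 ∷ 434857 ∷ 465917 ∷ 499189 ∷ 534841 ∷ 573031 ∷ 613957 ∷
  657809 ∷ 704783 ∷ 755107 ∷ 809041 ∷ 866819 ∷ 928703 ∷ 995023 ∷ 1066067 ∷ 1142201 ∷ 1223777 ∷
  1311181 ∷ 1404833 ∷ 1505177 ∷ 1612679 ∷ 1727851 ∷ 1851259 ∷ 1983491 ∷ 2125163 ∷ 2276957 ∷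
  2439571 ∷ 2613817 ∷ 2800513 ∷ 3000541 ∷ 3214837 ∷ 3444449 ∷ 3690473 ∷ 3954077 ∷ 4236461 ∷
  4539013 ∷ 4863223 ∷ 5210591 ∷ 5582771 ∷ 5981539 ∷ 6408791 ∷ 6866551 ∷ 7357003 ∷ 7882489 ∷
  8445523 ∷ 9048773 ∷ 9695099 ∷ 10387603 ∷ 11129537 ∷ 11924503 ∷ 12776251 ∷ 13688819 ∷ 14666579 ∷
  15714191 ∷ 16836629 ∷ 18039233 ∷ 19327747 ∷ 20708297 ∷ 22187461 ∷ 23772277 ∷ 25470257 ∷
  27289553 ∷ 29238787 ∷ 31327229 ∷ 33564877 ∷ 35962309 ∷ 38531029 ∷ 41283241 ∷ 44232043 ∷
  47391439 ∷ 50776519 ∷ 54403409 ∷ 58289339 ∷ 62452861 ∷ 66913747 ∷ 71693263 ∷ 76814191 ∷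
  82300903 ∷ 88179467 ∷ 94477991 ∷ 101226401 ∷ 108456851 ∷ 116203741 ∷ 124504007 ∷ 133397141 ∷
  142925479 ∷ 153134431 ∷ 164072591 ∷ 175791991 ∷ 188348549 ∷ 201802009 ∷ 216216379 ∷ 231660397 ∷
  248207543 ∷ 265936633 ∷ 284932091 ∷ 305284379 ∷ 327090403 ∷ 350453989 ∷ 375486401 ∷ 402306847 ∷
  431043049 ∷ 461831833 ∷ 494819783 ∷ 530164031 ∷ 568032887 ∷ 608606641 ∷ 652078529 ∷ 698655563 ∷
  748559477 ∷ 802028011 ∷ 859315697 ∷ 920695351 ∷ 986459269 ∷ 1056920629 ∷ 1132414937 ∷
  1213301711 ∷ 1299966113 ∷ 1392820817 ∷ 1492308001 ∷ 1598901377 ∷ 1713108613 ∷ 1835473501 ∷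
  1966578743 ∷ 2107048637 ∷ 2257552079 ∷ 2418805759 ∷ 2591577589 ∷ 2776690253 ∷ 2975025259 ∷
  3187527041 ∷ 3415207517 ∷ 3659150851 ∷ 3920518759 ∷ 4200555809 ∷ 4500595507 ∷ 4822066597 ∷ []

-- The upper end is 4 ^ 18 / 15 rounded up. No chain can start at a smaller prime: 139 and 149 are
-- consecutive primes, and 14 * 149 = 2086 exceeds 15 * 139 = 2085.
nextPrime-ladder : ∀ y → 149 ≤ y → y < 4581298450 → NextPrime y
nextPrime-ladder = ladder-sound 100000 4581298450 149 ladder refl

-- ⌊15y/p⌋ = 14 means y < p ≤ 15y/14.
nextPrime-large : ∀ y → 4581298450 ≤ y → NextPrime y
nextPrime-large y 4581298450≤y with anyUpTo? (λ p → prime? p ×-dec ¬? (Functional.hit sieve (15 * y ÷ p) ≟ 0)) (suc (15 * y))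
... | yes (p , _ , pp , hit≢0) = p , pp , y<p , ≤∧≢⇒< 14p≤15y 14p≢15y
  where
  W = 15 * y ÷ p
  1≤p : 1 ≤ p
  1≤p = >-nonZero⁻¹ p {{prime⇒nonZero pp}}
  W÷15≡0 : W ÷ 15 ≡ 0
  W÷15≡0 = n<1⇒n≡0 (≰⇒> λ 1≤ → hit≢0 (m≤n⇒m∸n≡0 (≤-trans (m⊓n≤m 1 (W ÷ 14)) 1≤)))
  14≤W : 14 ≤ W
  14≤W = ≮⇒≥ λ W<14 → hit≢0 (trans (cong (λ k → 1 ⊓ k ∸ W ÷ 15) (m<n⇒m/n≡0 W<14)) (0∸n≡0 (W ÷ 15)))
  W<15 : W < 15
  W<15 = m/n≡0⇒m<n W÷15≡0
  14p≤15y : 14 * p ≤ 15 * y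
  14p≤15y = ≤-trans (≤-trans (*-monoˡ-≤ p 14≤W) (≤-reflexive (*-comm W p))) (n*[m÷n]≤m (15 * y) p)
  y<p : y < p
  y<p = *-cancelˡ-< 15 y p (≰⇒> λ 15p≤15y → <⇒≱ W<15 (15≤W 15p≤15y))
    where
    15≤W : 15 * p ≤ 15 * y → 15 ≤ W
    15≤W 15p≤15y = ≤-trans (≤-reflexive (sym (trans (cong (_÷ p) (*-comm 15 p)) (n*k÷n p 15 1≤p)))) (÷-monoˡ-≤ p 15p≤15y)
  -- Equality would make p divide 15 or y, but p exceeds both.
  14p≢15y : 14 * p ≢ 15 * y
  14p≢15y e with euclidsLemma 15 y pp (subst (p ∣_) e (divides 14 refl))
  ... | inj₁ p∣15 = <⇒≱ (<-trans (≤-trans (≤ᵇ⇒≤ 16 4581298450 tt) 4581298450≤y) y<p) (∣⇒≤ p∣15)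
  ... | inj₂ p∣y  = <⇒≱ y<p (∣⇒≤ {{>-nonZero (≤-trans (≤ᵇ⇒≤ 1 4581298450 tt) 4581298450≤y)}} p∣y)
... | no none = contradiction no-hits (sieve-hits-prime (15 * y) (≤-trans (≤ᵇ⇒≤ (4 ^ 18) (15 * 4581298450) tt) (*-monoʳ-≤ 15 4581298450≤y)))
  where
  no-hits : ∀ p → Prime p → Functional.hit sieve (15 * y ÷ p) ≡ 0
  no-hits p pp with Functional.hit sieve (15 * y ÷ p) ≟ 0
  ... | yes z = z
  ... | no ≢0 with p ≤? 15 * y
  ...   | yes p≤ = contradiction (p , s≤s p≤ , pp , ≢0) none
  ...   | no p≰  = contradiction (cong (Functional.hit sieve) (÷≡0 (≰⇒> p≰))) ≢0

nextPrime : ∀ y → 149 ≤ y → NextPrime y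
nextPrime y 149≤y with 4581298450 ≤? y
... | yes large = nextPrime-large y large
... | no  small = nextPrime-ladder y 149≤y (≰⇒> small)

primeWithin : ℕ → ℕ → ℕ → Bool
primeWithin f zero    a = false
primeWithin f (suc c) a = isPrime f (suc a) ∨ primeWithin f c (suc a)

primeWithin-sound : ∀ f c a → T (primeWithin f c a) → ∃ λ p → Prime p × a < p × p ≤ a + c
primeWithin-sound f (suc c) a t with ∨-split {isPrime f (suc a)} t
... | inj₁ pr = suc a , isPrime-sound f (suc a) pr , ≤-refl , ≤-trans (s≤s (m≤m+n a c)) (≤-reflexive (sym (+-suc a c)))
... | inj₂ t′ with primeWithin-sound f c (suc a) t′
...   | p , pp , a<p , p≤ = p , pp , <-trans (n<1+n a) a<p , ≤-trans p≤ (≤-reflexive (sym (+-suc a c)))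

smallCase : ℕ → ℕ → ℕ → Bool
smallCase f k n = (n ≤ᵇ 1) ∨ primeWithin f (n ∸ 1) (k * n)

-- For kn ≥ 149 the prime comes from `nextPrime` at y = kn, as 15k ≤ 14(k + 1). Otherwise n ≤ kn <
-- 149, which leaves finitely many n.
prime-in-interval : ∀ f k top → 1 ≤ k → k ≤ 14 → 149 ≤ top → below (smallCase f k) top ≡ true →
  ∀ n → 1 < n → ∃ λ p → Prime p × k * n < p × p < (k + 1) * n
prime-in-interval f k top 1≤k k≤14 149≤top checked n 1<n with 149 ≤? k * n
... | yes 149≤kn with nextPrime (k * n) 149≤kn
...   | p , pp , kn<p , 14p<15kn = p , pp , kn<p , *-cancelˡ-< 14 p _ (<-≤-trans 14p<15kn (begin
        15 * (k * n)          ≡⟨ e₁ k n ⟩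
        14 * (k * n) + k * n  ≤⟨ +-monoʳ-≤ (14 * (k * n)) (*-monoˡ-≤ n k≤14) ⟩
        14 * (k * n) + 14 * n ≡⟨ e₂ k n ⟩
        14 * ((k + 1) * n)    ∎))
  where
  open ≤-Reasoning
  e₁ : ∀ k n → 15 * (k * n) ≡ 14 * (k * n) + k * n
  e₁ = solve-∀
  e₂ : ∀ k n → 14 * (k * n) + 14 * n ≡ 14 * ((k + 1) * n)
  e₂ = solve-∀
prime-in-interval f k top 1≤k k≤14 149≤top checked n@(suc n-1) 1<n | no 149≰kn
  with ∨-split {n ≤ᵇ 1} (below-sound (smallCase f k) top (true⇒T checked) (<-≤-trans (≤-<-trans (m≤n*m n k {{>-nonZero 1≤k}}) (≰⇒> 149≰kn)) 149≤top))
... | inj₁ n≤1 = contradiction (≤ᵇ⇒≤ n 1 n≤1) (<⇒≱ 1<n)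
... | inj₂ t with primeWithin-sound f n-1 (k * n) t
...   | p , pp , kn<p , p≤ = p , pp , kn<p , ≤-<-trans p≤ (subst (k * n + n-1 <_) (e k n) (+-monoʳ-< (k * n) ≤-refl))
  where
  e : ∀ k n → k * n + n ≡ (k + 1) * n
  e = solve-∀

-- Intervals without primes

CommonDivisor : ℕ → ℕ → Set
CommonDivisor a b = ∃ λ d → 1 < d × d ∣ a × d ∣ b

-- mod-helper 0 b a b is a % suc b, with fewer evaluation steps.
euclid : ℕ → ℕ → ℕ → Bool
euclid zero    a b       = false
euclid (suc f) a zero    = 1 <ᵇ a
euclid (suc f) a (suc b) = euclid f (suc b) (mod-helper 0 b a b)

euclid-sound : ∀ f a b → T (euclid f a b) → CommonDivisor a b
euclid-sound (suc f) a zero    t = a , <ᵇ⇒< 1 a t , ∣-refl , a ∣0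
euclid-sound (suc f) a (suc b) t with euclid-sound f (suc b) (a % suc b) t
... | d , 1<d , d∣b , d∣a%b = d , 1<d , ∣n∣m%n⇒∣m d∣b d∣a%b , d∣b

isZero : ℕ → Bool
isZero zero    = true
isZero (suc _) = false

isZero-sound : ∀ n → T (isZero n) → n ≡ 0
isZero-sound zero _ = refl

-- The tests modulo 2 and 3 only save time.
meets : ℕ → ℕ → ℕ → Bool
meets f P N = isZero (N % 2) ∨ (isZero (N % 3) ∨ euclid f P N)

meets-sound : ∀ f P N → 6 ∣ P → T (meets f P N) → CommonDivisor P N
meets-sound f P N 6∣P t with ∨-split {isZero (N % 2)} t
... | inj₁ z = 2 , s≤s (s≤s z≤n) , ∣-trans (divides 3 refl) 6∣P , m%n≡0⇒n∣m N 2 (isZero-sound _ z)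
... | inj₂ t′ with ∨-split {isZero (N % 3)} t′
...   | inj₁ z = 3 , s≤s (s≤s z≤n) , ∣-trans (divides 2 refl) 6∣P , m%n≡0⇒n∣m N 3 (isZero-sound _ z)
...   | inj₂ e = euclid-sound f P N e

blocked : ℕ → ℕ → ℕ → ℕ → Bool
blocked f P a zero    = true
blocked f P a (suc j) = meets f P (a + suc j) ∧ blocked f P a j

Blocked : ℕ → ℕ → ℕ → Set
Blocked P k n = ∀ j → 1 ≤ j → j < n → CommonDivisor P (k * n + j)

blocked-sound : ∀ f P a m → 6 ∣ P → T (blocked f P a m) → ∀ j → 1 ≤ j → j ≤ m → CommonDivisor P (a + j)
blocked-sound f P a zero    6∣P t (suc j) 1≤j ()
blocked-sound f P a (suc m) 6∣P t j 1≤j j≤m with ∧-split {meets f P (a + suc m)} t | j ≟ suc m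
... | now , _    | yes refl = meets-sound f P (a + suc m) 6∣P now
... | _    , rest | no j≢    = blocked-sound f P a m 6∣P rest j 1≤j (≤-pred (≤∧≢⇒< j≤m j≢))

-- The length tried is suc n, with n interior points, so starting from n = 1 the c attempts are the
-- lengths 2, ..., c + 1.
covered : ℕ → ℕ → ℕ → ℕ → ℕ → Bool
covered f P k zero    n = false
covered f P k (suc c) n = blocked f P (k * suc n) n ∨ covered f P k c (suc n)

covered-sound : ∀ f P k c n → 6 ∣ P → 1 ≤ n → T (covered f P k c n) → ∃ λ n → 1 < n × Blocked P k n
covered-sound f P k (suc c) n 6∣P 1≤n t with ∨-split {blocked f P (k * suc n) n} t
... | inj₁ b  = suc n , s≤s 1≤n , λ j 1≤j j<n → blocked-sound f P (k * suc n) n 6∣P b j 1≤j (≤-pred j<n)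
... | inj₂ t′ = covered-sound f P k c (suc n) 6∣P (m≤n⇒m≤1+n 1≤n) t′

-- The residues of k modulo 6, 6·5, 6·5·7, … are searched for some n such that every kn + j
-- with 0 < j < n shares a factor with the modulus; residues that survive all levels are
-- searched number by number, with P in place of the modulus.
module Tree (f cᵐ c lo P : ℕ) where

  leaf : ℕ → ℕ → ℕ → Bool
  leaf M zero    k = true
  leaf M (suc t) k = ((k <ᵇ lo) ∨ covered f P k c 1) ∧ leaf M t (k + M)

  mutual
    tree : ℕ → List ℕ → ℕ → ℕ → Bool
    tree reps []       M r = covered f M r cᵐ 1 ∨ leaf M reps r
    tree reps (p ∷ ps) M r = covered f M r cᵐ 1 ∨ branches reps p ps M p r

    branches : ℕ → ℕ → List ℕ → ℕ → ℕ → ℕ → Bool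
    branches reps p ps M zero    r = true
    branches reps p ps M (suc i) r = tree reps ps (M * p) r ∧ branches reps p ps M i (r + M)

  Gap : ℕ → Set
  Gap k = ∃ λ n → 1 < n × Blocked P k n

  period : List ℕ → ℕ → ℕ
  period []       M = M
  period (p ∷ ps) M = period ps (M * p)

  M∣period : ∀ ps M → M ∣ period ps M
  M∣period []       M = ∣-refl
  M∣period (p ∷ ps) M = ∣-trans (m∣m*n p) (M∣period ps (M * p))

  leaf-sound : ∀ M t k → 6 ∣ P → T (leaf M t k) → ∀ i → i < t → lo ≤ k + i * M → Gap (k + i * M)
  leaf-sound M (suc t) k 6∣P ok i i<t lo≤ with ∧-split {(k <ᵇ lo) ∨ covered f P k c 1} ok
  leaf-sound M (suc t) k 6∣P ok zero    i<t lo≤ | now , _ with ∨-split {k <ᵇ lo} now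
  ... | inj₁ k<lo = contradiction (subst (lo ≤_) (+-identityʳ k) lo≤) (<⇒≱ (<ᵇ⇒< k lo k<lo))
  ... | inj₂ cov  = subst Gap (sym (+-identityʳ k)) (covered-sound f P k c 1 6∣P ≤-refl cov)
  leaf-sound M (suc t) k 6∣P ok (suc i) i<t lo≤ | _ , rest =
    subst Gap (+-assoc k M (i * M)) (leaf-sound M t (k + M) 6∣P rest i (≤-pred i<t) (subst (lo ≤_) (sym (+-assoc k M (i * M))) lo≤))

  -- A common divisor of M and r n + j also divides (r + i M) n + j, so the same n works for the
  -- whole residue class.
  class-gap : ∀ M r → 6 ∣ M → M ∣ P → T (covered f M r cᵐ 1) → ∀ i → Gap (r + i * M)
  class-gap M r 6∣M M∣P t i with covered-sound f M r cᵐ 1 6∣M ≤-refl t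
  ... | n , 1<n , b = n , 1<n , λ j 1≤j j<n → let d , 1<d , d∣M , d∣N = b j 1≤j j<n in
        d , 1<d , ∣-trans d∣M M∣P , subst (d ∣_) (e r i M n j) (∣m∣n⇒∣m+n d∣N (∣-trans d∣M (m∣m*n (i * n))))
    where
    e : ∀ r i M n j → r * n + j + M * (i * n) ≡ (r + i * M) * n + j
    e = solve-∀

  period-0 : ∀ ps → period ps 0 ≡ 0
  period-0 []       = refl
  period-0 (p ∷ ps) = period-0 ps

  mutual
    tree-sound : ∀ reps ps M r → 1 ≤ M → 6 ∣ M → 6 ∣ P → period ps M ∣ P → T (tree reps ps M r) →
      ∀ i → lo ≤ r + i * M → r + i * M < reps * period ps M → Gap (r + i * M)
    tree-sound reps [] M r 1≤M 6∣M 6∣P per t i lo≤ <hi with ∨-split {covered f M r cᵐ 1} t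
    ... | inj₁ cov = class-gap M r 6∣M per cov i
    ... | inj₂ l   = leaf-sound M reps r 6∣P l i (*-cancelʳ-< M i reps (≤-<-trans (m≤n+m (i * M) r) <hi)) lo≤
    tree-sound reps (p ∷ ps) M r 1≤M 6∣M 6∣P per t i lo≤ <hi with ∨-split {covered f M r cᵐ 1} t
    ... | inj₁ cov = class-gap M r 6∣M (∣-trans (M∣period (p ∷ ps) M) per) cov i
    ... | inj₂ b   = split p refl
      where
      split : ∀ q → q ≡ p → Gap (r + i * M)
      -- For p = 0 the period is 0, and no number lies below the upper bound.
      split zero    refl = contradiction (<-≤-trans <hi (≤-reflexive (trans (cong (λ m → reps * period ps m) (*-zeroʳ M)) (trans (cong (reps *_) (period-0 ps)) (*-zeroʳ reps))))) λ ()
      split q@(suc _) refl = subst Gap (sym (e r i q M)) (branches-sound reps p ps M p r 1≤M 6∣M 6∣P per b (i % q) (i / q) (m%n<n i q)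
          (subst (lo ≤_) (e r i q M) lo≤) (subst (_< reps * period ps (M * p)) (e r i q M) <hi))
        where
        e : ∀ r i q M .{{_ : NonZero q}} → r + i * M ≡ r + i % q * M + i / q * (M * q)
        e r i q M = trans (cong (λ k → r + k * M) (m≡m%n+[m/n]*n i q)) (rearr r (i % q) (i / q) q M)
          where
          rearr : ∀ r a b q M → r + (a + b * q) * M ≡ r + a * M + b * (M * q)
          rearr = solve-∀

    branches-sound : ∀ reps p ps M s r → 1 ≤ M → 6 ∣ M → 6 ∣ P → period ps (M * p) ∣ P → T (branches reps p ps M s r) →
      ∀ a b → a < s → lo ≤ r + a * M + b * (M * p) → r + a * M + b * (M * p) < reps * period ps (M * p) → Gap (r + a * M + b * (M * p))
    branches-sound reps p ps M (suc s) r 1≤M 6∣M 6∣P per t zero b a<s lo≤ <hi with ∧-split {tree reps ps (M * p) r} t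
    ... | now , _ = subst (λ k → Gap (k + b * (M * p))) (sym (+-identityʳ r))
          (tree-sound reps ps (M * p) r (positive p refl) (∣m⇒∣m*n p 6∣M) 6∣P per now b
            (subst (λ k → lo ≤ k + b * (M * p)) (+-identityʳ r) lo≤) (subst (λ k → k + b * (M * p) < reps * period ps (M * p)) (+-identityʳ r) <hi))
      where
      positive : ∀ q → q ≡ p → 1 ≤ M * p
      positive zero refl = contradiction (<-≤-trans <hi (≤-reflexive (trans (cong (λ m → reps * period ps m) (*-zeroʳ M)) (trans (cong (reps *_) (period-0 ps)) (*-zeroʳ reps))))) λ ()
      positive (suc q) refl = *-mono-≤ 1≤M (s≤s z≤n)
    branches-sound reps p ps M (suc s) r 1≤M 6∣M 6∣P per t (suc a) b a<s lo≤ <hi with ∧-split {tree reps ps (M * p) r} t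
    ... | _ , rest = subst (λ k → Gap (k + b * (M * p))) (+-assoc r M (a * M))
          (branches-sound reps p ps M s (r + M) 1≤M 6∣M 6∣P per rest a b (≤-pred a<s)
            (subst (λ k → lo ≤ k + b * (M * p)) (sym (+-assoc r M (a * M))) lo≤) (subst (λ k → k + b * (M * p) < reps * period ps (M * p)) (sym (+-assoc r M (a * M))) <hi))

∤! : ∀ {p} n → Prime p → n < p → ¬ p ∣ n !
∤! zero    pp n<p p∣ = contradiction (subst Prime (∣1⇒≡1 p∣) pp) ¬prime[1]
∤! (suc n) pp n<p p∣ with euclidsLemma (suc n) (n !) pp p∣
... | inj₁ p∣1+n = <⇒≱ n<p (∣⇒≤ p∣1+n)
... | inj₂ p∣n!  = ∤! n pp (<⇒≤ n<p) p∣n!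

-- A divisor d > 1 of a prime p is p itself, but p > kn ≥ 2k > B cannot divide B !.
blocked-composite : ∀ B k n → B < 2 * k → 1 < n → Blocked (B !) k n →
  ¬ (∃ λ p → Prime p × k * n < p × p < (k + 1) * n)
blocked-composite B k n B<2k 1<n blocked (p , pp , kn<p , p<) with blocked (p ∸ k * n) (m<n⇒0<n∸m kn<p)
      (+-cancelˡ-< (k * n) _ _ (subst₂ _<_ (sym (m+[n∸m]≡n (<⇒≤ kn<p))) (e k n) p<))
  where
  e : ∀ k n → (k + 1) * n ≡ k * n + n
  e = solve-∀
... | d , 1<d , d∣B! , d∣ with prime⇒irreducible pp (subst (d ∣_) (m+[n∸m]≡n (<⇒≤ kn<p)) d∣)
...   | inj₁ d≡1 = <⇒≢ 1<d (sym d≡1)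
...   | inj₂ refl = ∤! B pp (<-trans (<-≤-trans B<2k (≤-trans (*-monoˡ-≤ k 1<n) (≤-reflexive (*-comm n k)))) kn<p) d∣B!

-- The exceptional values of k

exceptions : List ℕ
exceptions = 1 ∷ 2 ∷ 3 ∷ 5 ∷ 9 ∷ 14 ∷ []

HasPrimes : ℕ → Set
HasPrimes k = ∀ n → 1 < n → ∃ λ p → Prime p × k * n < p × p < (k + 1) * n

exceptionalOrCovered : ℕ → ℕ → ℕ → ℕ → Bool
exceptionalOrCovered f c P k = ⌊ _∈?_ _≟_ k exceptions ⌋ ∨ covered f P k c 1

exceptional-below : ∀ f c B lo len → 3 ≤ B → B < 2 * lo →
  below (λ i → exceptionalOrCovered f c (B !) (lo + i)) len ≡ true →
  ∀ k → lo ≤ k → k < lo + len → HasPrimes k → k ∈ exceptions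
exceptional-below f c B lo len 3≤B B<2lo checked k lo≤k k< primes
  with ∨-split {⌊ _∈?_ _≟_ k exceptions ⌋} (subst (λ k → T (exceptionalOrCovered f c (B !) k)) (m+[n∸m]≡n lo≤k)
         (below-sound (λ i → exceptionalOrCovered f c (B !) (lo + i)) len (true⇒T checked)
           (+-cancelˡ-< lo _ _ (subst (_< lo + len) (sym (m+[n∸m]≡n lo≤k)) k<))))
... | inj₁ isException = toWitness isException
... | inj₂ cov with covered-sound f (B !) k c 1 (m≤n⇒m!∣n! 3≤B) ≤-refl cov
...   | n , 1<n , b = contradiction (primes n 1<n) (blocked-composite B k n (<-≤-trans B<2lo (*-monoʳ-≤ 2 lo≤k)) 1<n b)

no-primes-beyond : ∀ f cᵐ c lo B reps ps → 3 ≤ B → B < 2 * lo → Tree.period f cᵐ c lo (B !) ps 6 ∣ B ! →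
  below (Tree.tree f cᵐ c lo (B !) reps ps 6) 6 ≡ true →
  ∀ k → lo ≤ k → k < reps * Tree.period f cᵐ c lo (B !) ps 6 → ¬ HasPrimes k
no-primes-beyond f cᵐ c lo B reps ps 3≤B B<2lo per checked k lo≤k k< primes =
  let n , 1<n , b = subst Gap (sym k≡) (tree-sound reps ps 6 (k % 6) (s≤s z≤n) ∣-refl (m≤n⇒m!∣n! 3≤B) per
        (below-sound (tree reps ps 6) 6 (true⇒T checked) (m%n<n k 6)) (k / 6) (subst (lo ≤_) k≡ lo≤k) (subst (_< reps * period ps 6) k≡ k<))
  in blocked-composite B k n (<-≤-trans B<2lo (*-monoʳ-≤ 2 lo≤k)) 1<n b (primes n 1<n)
  where
  open Tree f cᵐ c lo (B !)
  k≡ : k ≡ k % 6 + k / 6 * 6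
  k≡ = m≡m%n+[m/n]*n k 6

no-primes-large : ∀ k → 1024 ≤ k → k < 98 * 510510 → ¬ HasPrimes k
-- Residue classes are searched with n ≤ 12, single numbers with n ≤ 41. The period is 6 * 5 * 7 *
-- 11 * 13 * 17 = 510510, and 98 periods are the fewest that pass 50000000. The witness 696729600 is
-- 17! / 510510.
no-primes-large = no-primes-beyond 60 11 40 1024 2000 98 (5 ∷ 7 ∷ 11 ∷ 13 ∷ 17 ∷ [])
  (≤ᵇ⇒≤ 3 2000 tt) (≤ᵇ⇒≤ 2001 2048 tt) (∣-trans (divides 696729600 refl) (m≤n⇒m!∣n! (≤ᵇ⇒≤ 17 2000 tt))) refl

-- A larger B provides more common factors, but B < 2k has to hold throughout a range. The ranges
-- therefore start at 4, 16 and 64, each with the largest admissible B, namely 7, 31 and 127.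
exceptional-small : ∀ k → 4 ≤ k → k < 1024 → HasPrimes k → k ∈ exceptions
exceptional-small k 4≤k k<1024 with k <? 16 | k <? 64
... | yes k<16 | _       = exceptional-below 60 24 7 4 12 (≤ᵇ⇒≤ 3 7 tt) (≤ᵇ⇒≤ 8 8 tt) refl k 4≤k k<16
... | no  16≤k | yes k<64 = exceptional-below 60 24 31 16 48 (≤ᵇ⇒≤ 3 31 tt) (≤ᵇ⇒≤ 32 32 tt) refl k (≮⇒≥ 16≤k) k<64
... | no  _    | no 64≤k  = exceptional-below 60 24 127 64 960 (≤ᵇ⇒≤ 3 127 tt) (≤ᵇ⇒≤ 128 128 tt) refl k (≮⇒≥ 64≤k) k<1024

exceptional : ∀ k → 1 ≤ k → k ≤ 50000000 → HasPrimes k → k ∈ exceptions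
exceptional 1 _ _ _ = here refl
exceptional 2 _ _ _ = there (here refl)
exceptional 3 _ _ _ = there (there (here refl))
exceptional k@(suc (suc (suc (suc _)))) _ k≤ primes with k <? 1024
... | yes k<1024 = exceptional-small k (s≤s (s≤s (s≤s (s≤s z≤n)))) k<1024 primes
... | no  1024≤k = contradiction primes (no-primes-large k (≮⇒≥ 1024≤k) (≤-<-trans k≤ (≤ᵇ⇒≤ 50000001 (98 * 510510) tt)))

exceptions-have-primes : ∀ {k} → k ∈ exceptions → HasPrimes k
exceptions-have-primes (here refl)                                         = prime-in-interval 20 1 149 (≤ᵇ⇒≤ 1 1 tt) (≤ᵇ⇒≤ 1 14 tt) ≤-refl refl
exceptions-have-primes (there (here refl))                                 = prime-in-interval 30 2 149 (≤ᵇ⇒≤ 1 2 tt) (≤ᵇ⇒≤ 2 14 tt) ≤-refl refl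
exceptions-have-primes (there (there (here refl)))                         = prime-in-interval 40 3 149 (≤ᵇ⇒≤ 1 3 tt) (≤ᵇ⇒≤ 3 14 tt) ≤-refl refl
exceptions-have-primes (there (there (there (here refl))))                 = prime-in-interval 40 5 149 (≤ᵇ⇒≤ 1 5 tt) (≤ᵇ⇒≤ 5 14 tt) ≤-refl refl
exceptions-have-primes (there (there (there (there (here refl)))))         = prime-in-interval 50 9 149 (≤ᵇ⇒≤ 1 9 tt) (≤ᵇ⇒≤ 9 14 tt) ≤-refl refl
exceptions-have-primes (there (there (there (there (there (here refl)))))) = prime-in-interval 60 14 149 (≤ᵇ⇒≤ 1 14 tt) (≤ᵇ⇒≤ 14 14 tt) ≤-refl refl

theorem1 : ∀ (k : ℕ) → 1 ≤ k → k ≤ 50000000 →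
    (∀ (n : ℕ) → 1 < n → ∃ λ p → Prime p × k * n < p × p < (k + 1) * n)
    ⇔ (k ∈ 1 ∷ 2 ∷ 3 ∷ 5 ∷ 9 ∷ 14 ∷ [])
theorem1 k 1≤k k≤50000000 = mk⇔ (exceptional k 1≤k k≤50000000) exceptions-have-primes
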